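{- Let $n\ge 2$. For any two locally valid MV assignments $\mu_1,\mu_2$ of $M_{2,n}$ there exist proper $3$-colorings $\gamma,\beta$ of $M^*_{2,n}$ corresponding to $\mu_1,\mu_2$ respectively such that $$\min_{H\in 2\mathbb{Z}}\ \frac12\sum_{v\in V(M^*_{2,n})}\bigl|H+h_{\gamma,v_{1,1}}(\beta,v)\bigr|\le\left\lceil \frac{n^2}{2}\right\rceil .$$ Consequently the distance between $\mu_1$ and $\mu_2$ in ${\rm OFG}(M_{2,n})$ is at most $\lceil n^2/2\rceil$, the distance between two opposite vertices of degree $2$; that is, a pair of vertices at maximal distance is formed by two opposite degree-$2$ vertices.
   Context: The $2\times n$ Miura-ori $M_{2,n}$ has faces $\alpha_{i,j}$ ($i\in\{1,2\}$, $j\in\{1,\dots,n\}$), interior vertices $x_1,\dots,x_{n-1}$, creases $e_0$ and $e_{3k-1},e_{3k},e_{3k+1}$ ($k=1,\dots,n-1$); at $x_k$ the creases are left $e_{3k-3}$, top $e_{3k-1}$, right $e_{3k}$, bottom $e_{3k+1}$. Face $\alpha_{1,j}$ is bordered by those of $e_{3j-4}$ (iff $j\ge2$), $e_{3j-3}$, $e_{3j-1}$ (iff $j\le n-1$); $\alpha_{2,j}$ by those of $e_{3j-2}$ (iff $j\ge2$), $e_{3j-3}$, $e_{3j+1}$ (iff $j\le n-1$). An MV assignment $\mu$ maps creases to $\{1,-1\}$; it is locally valid if for each $k$ exactly one of $\mu(e_{3k-1}),\mu(e_{3k}),\mu(e_{3k+1})$ differs from $\mu(e_{3k-3})$. The face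 flip $\mu_\alpha$ negates $\mu$ on the creases bordering $\alpha$; $\alpha$ is flippable if $\mu,\mu_\alpha$ are both locally valid. ${\rm OFG}(M_{2,n})$ has the locally valid assignments as vertices, $\mu\sim\mu_\alpha$ for flippable $\alpha$. Opposite assignments: same flippable faces and opposite parity on every crease (i.e., $\mu$ and $-\mu$). $M^*_{2,n}$ is the grid graph on $v_{i,j}$ ($i\in\{1,2\}$, $1\le j\le n$), $v_{i,j}$ adjacent to $v_{i,j\pm1}$, $v_{3-i,j}$; colors in $\mathbb{Z}_3$. A proper $3$-coloring $\gamma$ corresponds to $\mu$ if, mod $3$: $\gamma(v_{1,j+1})=\gamma(v_{1,j})+\mu(e_{3j-1})$ for $1\le j\le n-1$; $\gamma(v_{2,n})=\gamma(v_{1,n})+\mu(e_{3n-3})$; $\gamma(v_{2,j-1})=\gamma(v_{2,j})+\mu(e_{3j-2})$ for $2\le j\le n$ (each locally valid $\mu$ corresponds to exactly three colorings, one per value of $\gamma(v_{1,1})$). Edge weight $w(\gamma,\overrightarrow{ab})\in\{1,-1\}$ with $w\equiv\gamma(b)-\gamma(a)$ mod $3$; path weight is the sum of edge weights (path independent). Relative height $h_{\gamma,u}(\beta,v)=w(\beta,P_{u,v})-w(\gamma,P_{u,v})$ for a directed path $P_{u,v}$ from $u$ to $v$. -}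

module Defs where

import Algebra.Properties.CommutativeMonoid.Sum
open import Data.Bool.Base using (if_then_else_)
open import Data.Fin.Base using (Fin; zero; suc; inject₁; toℕ)
open import Data.Fin.Patterns using (0F; 1F)
import Data.Fin.Properties as Fin
open import Data.Integer.Base as ℤ using (ℤ; +_; ∣_∣; 0ℤ; 1ℤ; -1ℤ; _◃_)
open import Data.Integer.Divisibility using (_∣_)
open import Data.Integer.DivMod using (_%ℕ_)
open import Data.List.Base using (List; []; _∷_; length; filter)
import Data.List.Membership.Setoid as Membership
import Data.List.Relation.Unary.Unique.Setoid as Unique
open import Data.Nat.Base as ℕ using (ℕ; zero; suc; _∸_; _≤_; s≤s)
import Data.Nat.Properties as ℕ
open import Data.Product.Base using (Σ; ∃; _×_; _,_; proj₁)
open import Data.Rational.Unnormalised.Base as ℚᵘ using (ℚᵘ)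
open import Data.Sign.Base using (Sign; opposite)
import Data.Sign.Properties as Sign
open import Data.Sum.Base using (_⊎_)
open import Function.Bundles using (_⇔_)
open import Level using (0ℓ)
open import Relation.Binary.Bundles using (Setoid)
import Relation.Binary.Construct.On as On
open import Relation.Binary.Construct.Closure.ReflexiveTransitive using (Star; ε; _◅_)
open import Relation.Binary.PropositionalEquality using (_≡_; _≢_; _≗_; _→-setoid_)
open import Relation.Nullary.Decidable using (Dec; ¬?; _×-dec_; _⊎-dec_; does)

private
  variable
    n : ℕ

infix 4 _∼_ _≡₃_

-- Indices are zero-based: 0F, 1F : Fin 2 are rows 1, 2 of α_{i,j} and v_{i,j};
-- j : Fin n is column toℕ j + 1; and k : Fin (n ∸ 1) is the
-- interior vertex x_{toℕ k + 1}, which lies between columns left k and right k.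

left : Fin (n ∸ 1) → Fin n
left {suc n} k = inject₁ k

right : Fin (n ∸ 1) → Fin n
right {suc n} k = suc k

-- In one-based indices, horizontal j is e_{3j-3} (so e_0 is the one with j = 1),
-- vertical 1 k is the top crease e_{3k-1} at x_k, and vertical 2 k the bottom
-- crease e_{3k+1}.  At x_k the left crease e_{3k-3} is horizontal (left k) and
-- the right crease e_{3k} is horizontal (right k).

data Crease (n : ℕ) : Set where
  horizontal : Fin n → Crease n
  vertical   : Fin 2 → Fin (n ∸ 1) → Crease n

Face : ℕ → Set
Face n = Fin 2 × Fin n

Borders : Crease n → Face n → Set
Borders (horizontal j′) (i , j) = j′ ≡ j
Borders (vertical i′ k) (i , j) = i′ ≡ i × (left k ≡ j ⊎ right k ≡ j)

borders? : (e : Crease n) (α : Face n) → Dec (Borders e α)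
borders? (horizontal j′) (i , j) = j′ Fin.≟ j
borders? (vertical i′ k) (i , j) =
  (i′ Fin.≟ i) ×-dec ((left k Fin.≟ j) ⊎-dec (right k Fin.≟ j))

Assignment : ℕ → Set
Assignment n = Crease n → Sign

LocallyValid : Assignment n → Set
LocallyValid {n} μ = (k : Fin (n ∸ 1)) →
  length (filter (λ e → ¬? (μ e Sign.≟ μ (horizontal (left k))))
                 (vertical 0F k ∷ horizontal (right k) ∷ vertical 1F k ∷ []))
    ≡ 1

flip : Assignment n → Face n → Assignment n
flip μ α e = if does (borders? e α) then opposite (μ e) else μ e

Flippable : Assignment n → Face n → Set
Flippable μ α = LocallyValid μ × LocallyValid (flip μ α)

Opposite : Assignment n → Assignment n → Set
Opposite μ ν = (∀ α → Flippable μ α ⇔ Flippable ν α) × (∀ e → ν e ≡ opposite (μ e))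

Vertex : ℕ → Set
Vertex n = Σ (Assignment n) LocallyValid

-- Vertices are identified when their assignments agree on every crease.
vertexSetoid : ℕ → Setoid 0ℓ 0ℓ
vertexSetoid n = On.setoid {B = Vertex n} (Crease n →-setoid Sign) proj₁

Adjacent : Vertex n → Vertex n → Set
Adjacent (μ , _) (ν , _) = ∃ λ α → Flippable μ α × ν ≗ flip μ α

data Walk {n : ℕ} : Vertex n → Vertex n → ℕ → Set where
  stop : ∀ {x y} → proj₁ x ≗ proj₁ y → Walk x y 0
  step : ∀ {x y z d} → Adjacent x y → Walk y z d → Walk x z (suc d)

IsDistance : Vertex n → Vertex n → ℕ → Set
IsDistance x y d = Walk x y d × (∀ d′ → Walk x y d′ → d ≤ d′)

HasDegree : Vertex n → ℕ → Set
HasDegree {n} x d = ∃ λ (ys : List (Vertex n)) →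
  U.Unique ys × (∀ y → Adjacent x y ⇔ y M.∈ ys) × length ys ≡ d
  where
  module U = Unique (vertexSetoid n)
  module M = Membership (vertexSetoid n)

Node : ℕ → Set
Node n = Fin 2 × Fin n

_∼_ : Node n → Node n → Set
(i , j) ∼ (i′ , j′) =
  (i ≡ i′ × (toℕ j′ ≡ suc (toℕ j) ⊎ toℕ j ≡ suc (toℕ j′))) ⊎ (i ≢ i′ × j ≡ j′)

v₁₁ : 2 ≤ n → Node n
v₁₁ (s≤s _) = 0F , zero

Coloring : ℕ → Set
Coloring n = Node n → Fin 3

Proper : Coloring n → Set
Proper γ = ∀ u v → u ∼ v → γ u ≢ γ v

color : Coloring n → Node n → ℤ
color γ v = + toℕ (γ v)

_≡₃_ : ℤ → ℤ → Set
x ≡₃ y = + 3 ∣ (x ℤ.- y)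

±1 : Sign → ℤ
±1 s = s ◃ 1

Corresponds : Coloring n → Assignment n → Set
Corresponds {n} γ μ =
  (∀ k → color γ (0F , right k) ≡₃ color γ (0F , left k) ℤ.+ ±1 (μ (vertical 0F k))) ×
  (∀ j → suc (toℕ j) ≡ n →
         color γ (1F , j) ≡₃ color γ (0F , j) ℤ.+ ±1 (μ (horizontal j))) ×
  (∀ k → color γ (1F , left k) ≡₃ color γ (1F , right k) ℤ.+ ±1 (μ (vertical 1F k)))

-- The representative of a residue mod 3 in {0, 1, -1}; the residue 0 does not occur along an edge of a properly colored graph.
balanced : ℕ → ℤ
balanced 1 = 1ℤ
balanced 2 = -1ℤ
balanced _ = 0ℤ

edgeWeight : Coloring n → Node n → Node n → ℤ
edgeWeight γ a b = balanced ((color γ b ℤ.- color γ a) %ℕ 3)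

Path : Node n → Node n → Set
Path = Star _∼_

pathWeight : Coloring n → {u v : Node n} → Path u v → ℤ
pathWeight γ ε = 0ℤ
pathWeight γ (_◅_ {a} {b} _ p) = edgeWeight γ a b ℤ.+ pathWeight γ p

relativeHeight : Coloring n → Coloring n → {u v : Node n} → Path u v → ℤ
relativeHeight γ β p = pathWeight β p ℤ.- pathWeight γ p

∑ : (Node n → ℕ) → ℕ
∑ f = sum λ i → sum λ j → f (i , j)
  where open Algebra.Properties.CommutativeMonoid.Sum ℕ.+-0-commutativeMonoid

-- ½ ∑_v |H + h_{γ,u}(β,v)|, where h_{γ,u}(β,v) is computed along P v.
halfSum : Coloring n → Coloring n → {u : Node n} → (∀ v → Path u v) → ℤ → ℚᵘ
halfSum γ β P H = + (∑ λ v → ∣ H ℤ.+ relativeHeight γ β (P v) ∣) ℚᵘ./ 2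

IsMinOver2ℤ : (ℤ → ℚᵘ) → ℚᵘ → Set
IsMinOver2ℤ f m =
  (∃ λ H → + 2 ∣ H × f H ℚᵘ.≃ m) × (∀ H → + 2 ∣ H → m ℚᵘ.≤ f H)

{-# OPTIONS --safe #-}

-- A locally valid assignment μ is the gradient of a height function f : V(M*) → ℤ that changes
-- by ±1 along every edge, and f is unique up to a constant.  A face is flippable exactly when
-- f has a local extremum there, and the flip moves f by 2 at that node.  Hence, if f and g
-- lift μ₁ and μ₂ and D = (g − f)/2, the distance of μ₁ and μ₂ is min_K ∑_v |K + D(v)|: each
-- flip changes the sum by at most 1, and as long as it is positive, a lowest node of f among
-- those with f < g (or dually) can be flipped towards g.
--
-- D is 1-Lipschitz on the 2 × n grid.  A shift K that is good on the two or three central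
-- columns bounds the sum by ⌈n²/2⌉, since each step outwards costs at most 1 per node.  In a
-- vertex of degree 2 the creases of each kind all have the same sign, so f is a staircase
-- with rows t j and t j + s (s, t = ±1).  For the opposite vertex D is then a staircase too,
-- and pairing nodes of the first and last columns shows that no shift beats ⌈n²/2⌉.

module Submission where

import Algebra.Properties.AbelianGroup as AbelianGroupProperties
open import Data.Bool.Base using (true; false; if_then_else_)
open import Data.Fin.Base using (Fin; zero; suc; inject₁; lower₁; toℕ; fromℕ; fromℕ<)
open import Data.Fin.Induction using (<-weakInduction)
open import Data.Fin.Patterns using (0F; 1F)
import Data.Fin.Properties as Fin
open import Data.Integer.Base as ℤ using (ℤ; +_; -[1+_]; ∣_∣; 0ℤ; 1ℤ; -1ℤ; _+_; _*_; -_; _-_)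
open import Data.Integer.Divisibility using (_∣_)
open import Data.Integer.Divisibility.Signed using (divides; ∣⇒∣ᵤ; ∣ᵤ⇒∣)
open import Data.Integer.DivMod using (_%ℕ_; _/ℕ_; n%ℕd<d; a≡a%ℕn+[a/ℕn]*n)
import Data.Integer.Properties as ℤ
open import Data.Integer.Tactic.RingSolver using (solve-∀)
open import Data.List.Base using (List; []; _∷_; _++_; length; filter; map; upTo; allFin; cartesianProduct)
open import Data.List.Extrema ℤ.≤-totalOrder using (argmin; argmin-all; f[argmin]≤f[xs])
open import Data.List.Membership.Propositional using (_∈_)
open import Data.List.Membership.Propositional.Properties using (∈-allFin; ∈-cartesianProduct⁺; ∈-filter⁺; ∈-++⁺ˡ; ∈-++⁺ʳ; ∈-map⁺; ∈-upTo⁺)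
import Data.List.Membership.Setoid as Membership
open import Data.List.Relation.Unary.All as All using ([]; _∷_)
open import Data.List.Relation.Unary.All.Properties using (all-filter)
open import Data.List.Relation.Unary.AllPairs using ([]; _∷_)
open import Data.List.Relation.Unary.Any using (here; there)
open import Data.Nat.Base as ℕ using (ℕ; zero; suc; z≤n; s≤s; _≤_; _^_; ⌈_/2⌉)
import Data.Nat.Divisibility as ℕ
import Data.Nat.Properties as ℕ
import Data.Nat.Tactic.RingSolver as ℕSolver
open import Data.Product.Base using (∃; ∃₂; _×_; _,_; proj₁; proj₂)
open import Data.Product.Properties using (≡-dec)
open import Data.Rational.Unnormalised.Base as ℚᵘ using ()
import Data.Rational.Unnormalised.Properties as ℚᵘ
open import Data.Sign.Base using (Sign; opposite) renaming (+ to ⊕; - to ⊖)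
import Data.Sign.Properties as Sign
open import Data.Sum.Base using (_⊎_; inj₁; inj₂; [_,_]′)
open import Function.Base using (_∘_; _$_; id)
open import Function.Bundles using (Equivalence; mk⇔)
open import Relation.Binary.Construct.Closure.ReflexiveTransitive using (ε; _◅_)
open import Relation.Binary.PropositionalEquality using (_≡_; _≢_; _≗_; refl; sym; trans; cong; cong₂; subst; subst₂; module ≡-Reasoning)
open import Relation.Nullary using (¬_; Dec; yes; no; contradiction)
open import Relation.Nullary.Decidable using (does; dec-true; dec-false; from-yes; ¬?; _→-dec_; _×-dec_; _⊎-dec_)
open import Defs

open import Algebra.Properties.CommutativeMonoid.Sum ℕ.+-0-commutativeMonoid using (sum; sum-cong-≗; sum-init-last; ∑-distrib-+)
import Data.List.Extrema ℕ.≤-totalOrder as ℕExtrema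

open AbelianGroupProperties ℤ.+-0-abelianGroup using () renaming (∙-cancelˡ to +-cancelˡ)

private variable
  m n : ℕ

-- Signs as integers

sign-dichotomy : ∀ a s → a ≡ s ⊎ a ≡ opposite s
sign-dichotomy ⊕ ⊕ = inj₁ refl
sign-dichotomy ⊕ ⊖ = inj₂ refl
sign-dichotomy ⊖ ⊕ = inj₂ refl
sign-dichotomy ⊖ ⊖ = inj₁ refl

±1-opposite : ∀ s → ±1 (opposite s) ≡ - ±1 s
±1-opposite ⊕ = refl
±1-opposite ⊖ = refl

∣±1∣ : ∀ s → ∣ ±1 s ∣ ≡ 1
∣±1∣ ⊕ = refl
∣±1∣ ⊖ = refl

±1-injective : ∀ {s t} → ±1 s ≡ ±1 t → s ≡ t
±1-injective {⊕} {⊕} _ = refl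
±1-injective {⊖} {⊖} _ = refl

-- Local validity as a conservation law

-- Three signs sum to `±1 l` exactly when two of them equal `l` and one is opposite, which is local
-- validity at a vertex with left, top, right and bottom creases `l`, `t`, `r`, `b`. The record
-- keeps the four signs inferable from a proof, which the bare integer equation would not.
record Conserves (l t r b : Sign) : Set where
  constructor conserves
  field balance : ±1 t + ±1 r + ±1 b ≡ ±1 l

Conserved : Assignment (suc m) → Set
Conserved μ = ∀ k → Conserves (μ (horizontal (inject₁ k))) (μ (vertical 0F k))
                              (μ (horizontal (suc k))) (μ (vertical 1F k))

length-filter-map : ∀ {A B : Set} {P : B → Set} (P? : ∀ b → Dec (P b)) (f : A → B) xs →
  length (filter (λ a → P? (f a)) xs) ≡ length (filter P? (map f xs))
length-filter-map P? f []       = refl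
length-filter-map P? f (x ∷ xs) with does (P? (f x))
... | true  = cong suc (length-filter-map P? f xs)
... | false = length-filter-map P? f xs

differing : Sign → Sign → Sign → Sign → ℕ
differing l t r b = length (filter (λ s → ¬? (s Sign.≟ l)) (t ∷ r ∷ b ∷ []))

one-differs⇒conserves : ∀ l t r b → differing l t r b ≡ 1 → Conserves l t r b
one-differs⇒conserves ⊕ ⊕ ⊕ ⊖ _ = conserves refl
one-differs⇒conserves ⊕ ⊕ ⊖ ⊕ _ = conserves refl
one-differs⇒conserves ⊕ ⊖ ⊕ ⊕ _ = conserves refl
one-differs⇒conserves ⊖ ⊕ ⊖ ⊖ _ = conserves refl
one-differs⇒conserves ⊖ ⊖ ⊕ ⊖ _ = conserves refl
one-differs⇒conserves ⊖ ⊖ ⊖ ⊕ _ = conserves refl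

conserves⇒one-differs : ∀ {l t r b} → Conserves l t r b → differing l t r b ≡ 1
conserves⇒one-differs {⊕} {⊕} {⊕} {⊕} (conserves ())
conserves⇒one-differs {⊕} {⊕} {⊕} {⊖} _ = refl
conserves⇒one-differs {⊕} {⊕} {⊖} {⊕} _ = refl
conserves⇒one-differs {⊕} {⊕} {⊖} {⊖} (conserves ())
conserves⇒one-differs {⊕} {⊖} {⊕} {⊕} _ = refl
conserves⇒one-differs {⊕} {⊖} {⊕} {⊖} (conserves ())
conserves⇒one-differs {⊕} {⊖} {⊖} {⊕} (conserves ())
conserves⇒one-differs {⊕} {⊖} {⊖} {⊖} (conserves ())
conserves⇒one-differs {⊖} {⊕} {⊕} {⊕} (conserves ())
conserves⇒one-differs {⊖} {⊕} {⊕} {⊖} (conserves ())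
conserves⇒one-differs {⊖} {⊕} {⊖} {⊕} (conserves ())
conserves⇒one-differs {⊖} {⊕} {⊖} {⊖} _ = refl
conserves⇒one-differs {⊖} {⊖} {⊕} {⊕} (conserves ())
conserves⇒one-differs {⊖} {⊖} {⊕} {⊖} _ = refl
conserves⇒one-differs {⊖} {⊖} {⊖} {⊕} _ = refl
conserves⇒one-differs {⊖} {⊖} {⊖} {⊖} (conserves ())

valid⇒conserved : (μ : Assignment (suc m)) → LocallyValid μ → Conserved μ
valid⇒conserved μ valid k = one-differs⇒conserves _ _ _ _
  (trans (sym (length-filter-map (λ s → ¬? (s Sign.≟ μ (horizontal (inject₁ k)))) μ
    (vertical 0F k ∷ horizontal (suc k) ∷ vertical 1F k ∷ []))) (valid k))

conserved⇒valid : (μ : Assignment (suc m)) → Conserved μ → LocallyValid μ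
conserved⇒valid μ conserved k =
  trans (length-filter-map (λ s → ¬? (s Sign.≟ μ (horizontal (inject₁ k)))) μ
    (vertical 0F k ∷ horizontal (suc k) ∷ vertical 1F k ∷ [])) (conserves⇒one-differs (conserved k))

conserves-swap : ∀ {l t r b} → Conserves l t r b → Conserves l b r t
conserves-swap {l} {t} {r} {b} (conserves p) = conserves (trans (swap (±1 t) (±1 r) (±1 b)) p)
  where
  swap : ∀ t r b → b + r + t ≡ t + r + b
  swap = solve-∀

-- Flipping a face at a vertex negates two consecutive creases there, so conservation
-- before and after forces these two to cancel.
left-corner : ∀ {l t r b} → Conserves l t r b → Conserves (opposite l) (opposite t) r b → t ≡ l
left-corner {⊕} {⊕} {⊕} {⊕} _ _ = refl
left-corner {⊕} {⊕} {⊕} {⊖} _ _ = refl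
left-corner {⊕} {⊕} {⊖} {⊕} _ _ = refl
left-corner {⊕} {⊕} {⊖} {⊖} _ _ = refl
left-corner {⊕} {⊖} {⊕} {⊕} _ (conserves ())
left-corner {⊕} {⊖} {⊕} {⊖} (conserves ())
left-corner {⊕} {⊖} {⊖} {⊕} (conserves ())
left-corner {⊕} {⊖} {⊖} {⊖} (conserves ())
left-corner {⊖} {⊕} {⊕} {⊕} (conserves ())
left-corner {⊖} {⊕} {⊕} {⊖} (conserves ())
left-corner {⊖} {⊕} {⊖} {⊕} (conserves ())
left-corner {⊖} {⊕} {⊖} {⊖} _ (conserves ())
left-corner {⊖} {⊖} {⊕} {⊕} _ _ = refl
left-corner {⊖} {⊖} {⊕} {⊖} _ _ = refl
left-corner {⊖} {⊖} {⊖} {⊕} _ _ = refl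
left-corner {⊖} {⊖} {⊖} {⊖} _ _ = refl

right-corner : ∀ {l t r b} → Conserves l t r b → Conserves l (opposite t) (opposite r) b → t ≡ opposite r
right-corner {⊕} {⊕} {⊕} {⊕} (conserves ())
right-corner {⊕} {⊕} {⊕} {⊖} _ (conserves ())
right-corner {⊕} {⊕} {⊖} {⊕} _ _ = refl
right-corner {⊕} {⊕} {⊖} {⊖} _ _ = refl
right-corner {⊕} {⊖} {⊕} {⊕} _ _ = refl
right-corner {⊕} {⊖} {⊕} {⊖} _ _ = refl
right-corner {⊕} {⊖} {⊖} {⊕} (conserves ())
right-corner {⊕} {⊖} {⊖} {⊖} (conserves ())
right-corner {⊖} {⊕} {⊕} {⊕} (conserves ())
right-corner {⊖} {⊕} {⊕} {⊖} (conserves ())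
right-corner {⊖} {⊕} {⊖} {⊕} _ _ = refl
right-corner {⊖} {⊕} {⊖} {⊖} _ _ = refl
right-corner {⊖} {⊖} {⊕} {⊕} _ _ = refl
right-corner {⊖} {⊖} {⊕} {⊖} _ _ = refl
right-corner {⊖} {⊖} {⊖} {⊕} _ (conserves ())
right-corner {⊖} {⊖} {⊖} {⊖} (conserves ())


-- Height functions

-- Creases are read as dual edges of the grid, oriented rightwards in the top row, downwards in each
-- column and leftwards in the bottom row. Around an interior vertex the top, right and bottom edges
-- then form a path with the same ends as the left edge.
source target : Crease (suc m) → Node (suc m)
source (horizontal j)  = 0F , j
source (vertical 0F k) = 0F , inject₁ k
source (vertical 1F k) = 1F , suc k
target (horizontal j)  = 1F , j
target (vertical 0F k) = 0F , suc k
target (vertical 1F k) = 1F , inject₁ k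

infix 4 _Lifts_

record _Lifts_ (f : Node (suc m) → ℤ) (μ : Assignment (suc m)) : Set where
  constructor lifting
  field along : ∀ e → f (target e) ≡ f (source e) + ±1 (μ e)

open _Lifts_

+-assoc₄ : ∀ a b c d → a + (b + c + d) ≡ a + b + c + d
+-assoc₄ = solve-∀

-- Around an interior vertex, the path over the top, right and bottom edges joins the same two nodes
-- as the left edge, so the height increments agree.
lifts⇒valid : ∀ {f} {μ : Assignment (suc m)} → f Lifts μ → LocallyValid μ
lifts⇒valid {f = f} {μ} lifts = conserved⇒valid μ λ k → conserves $
  +-cancelˡ (f (0F , inject₁ k)) _ _ $
  begin
    f (0F , inject₁ k) + (±1 (μ (vertical 0F k)) + ±1 (μ (horizontal (suc k))) + ±1 (μ (vertical 1F k)))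
      ≡⟨ +-assoc₄ (f (0F , inject₁ k)) _ _ _ ⟩
    f (0F , inject₁ k) + ±1 (μ (vertical 0F k)) + ±1 (μ (horizontal (suc k))) + ±1 (μ (vertical 1F k))
      ≡⟨ cong (λ x → x + ±1 (μ (horizontal (suc k))) + ±1 (μ (vertical 1F k))) (along lifts (vertical 0F k)) ⟨
    f (0F , suc k) + ±1 (μ (horizontal (suc k))) + ±1 (μ (vertical 1F k))
      ≡⟨ cong (_+ ±1 (μ (vertical 1F k))) (along lifts (horizontal (suc k))) ⟨
    f (1F , suc k) + ±1 (μ (vertical 1F k))
      ≡⟨ along lifts (vertical 1F k) ⟨
    f (1F , inject₁ k)
      ≡⟨ along lifts (horizontal (inject₁ k)) ⟩
    f (0F , inject₁ k) + ±1 (μ (horizontal (inject₁ k))) ∎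
  where
  open ≡-Reasoning

inject₁≢suc : (k : Fin m) → inject₁ k ≢ suc k
inject₁≢suc (suc k) eq = inject₁≢suc k (Fin.suc-injective eq)

prefixSum : (Fin m → ℤ) → Fin (suc m) → ℤ
prefixSum t zero = 0ℤ
prefixSum {suc m} t (suc k) = t zero + prefixSum (t ∘ suc) k

prefixSum-suc : (t : Fin m → ℤ) (k : Fin m) → prefixSum t (suc k) ≡ prefixSum t (inject₁ k) + t k
prefixSum-suc {suc m} t zero = ℤ.+-comm (t zero) 0ℤ
prefixSum-suc {suc m} t (suc k) =
  trans (cong (_+_ (t zero)) (prefixSum-suc (t ∘ suc) k)) (sym (ℤ.+-assoc (t zero) _ _))

height : Assignment (suc m) → Node (suc m) → ℤ
height μ (0F , j) = prefixSum (λ k → ±1 (μ (vertical 0F k))) j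
height μ (1F , j) = height μ (0F , j) + ±1 (μ (horizontal j))

-- `height` follows the top row and the columns by construction; conservation at each interior
-- vertex makes it consistent along the bottom row too.
height-lifts : (μ : Assignment (suc m)) → LocallyValid μ → height μ Lifts μ
height-lifts {m} μ valid = lifting λ
  { (horizontal j)  → refl
  ; (vertical 0F k) → prefixSum-suc _ k
  ; (vertical 1F k) → bottom k
  }
  where
  open ≡-Reasoning
  bottom : ∀ k → height μ (1F , inject₁ k) ≡ height μ (1F , suc k) + ±1 (μ (vertical 1F k))
  bottom k = begin
    a + ±1 (μ (horizontal (inject₁ k)))
      ≡⟨ cong (_+_ a) (Conserves.balance (valid⇒conserved μ valid k)) ⟨
    a + (±1 (μ (vertical 0F k)) + ±1 (μ (horizontal (suc k))) + ±1 (μ (vertical 1F k)))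
      ≡⟨ +-assoc₄ a _ _ _ ⟩
    a + ±1 (μ (vertical 0F k)) + ±1 (μ (horizontal (suc k))) + ±1 (μ (vertical 1F k))
      ≡⟨ cong (λ x → x + ±1 (μ (horizontal (suc k))) + ±1 (μ (vertical 1F k))) (prefixSum-suc _ k) ⟨
    height μ (0F , suc k) + ±1 (μ (horizontal (suc k))) + ±1 (μ (vertical 1F k)) ∎
    where a = height μ (0F , inject₁ k)

-- The top row and the columns form a spanning tree whose edges all point away from the top-left
-- node.
node-induction : (Q : Node (suc m) → Set) → Q (0F , zero) →
  (∀ e → Q (source e) → Q (target e)) → ∀ v → Q v
node-induction Q base next (0F , j) =
  <-weakInduction (λ j → Q (0F , j)) base (λ k → next (vertical 0F k)) j
node-induction Q base next (1F , j) = next (horizontal j) (node-induction Q base next (0F , j))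

-- Halved differences of two heights

δ : Sign → Sign → ℤ
δ ⊕ ⊕ = 0ℤ
δ ⊕ ⊖ = -1ℤ
δ ⊖ ⊕ = 1ℤ
δ ⊖ ⊖ = 0ℤ

δ-half : ∀ s t → ±1 t ≡ ±1 s + + 2 * δ s t
δ-half ⊕ ⊕ = refl
δ-half ⊕ ⊖ = refl
δ-half ⊖ ⊕ = refl
δ-half ⊖ ⊖ = refl

∣δ∣≤1 : ∀ s t → ∣ δ s t ∣ ℕ.≤ 1
∣δ∣≤1 ⊕ ⊕ = z≤n
∣δ∣≤1 ⊕ ⊖ = s≤s z≤n
∣δ∣≤1 ⊖ ⊕ = s≤s z≤n
∣δ∣≤1 ⊖ ⊖ = z≤n

-- A flip moves the height by 2, so `D v` is the net number of upward flips of face `v` that carries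
-- `f` to `g`.
record HalfDifference (f g D : Node (suc m) → ℤ) : Set where
  constructor halving
  field at : ∀ v → g v ≡ f v + + 2 * D v

open HalfDifference

regroup : ∀ a d s x → a + + 2 * d + (s + + 2 * x) ≡ a + s + + 2 * (d + x)
regroup = solve-∀

-- The two heights agree at the top-left node and both change parity along every edge, so their
-- parities agree everywhere.
halfDifference : ∀ {f g} {μ ν : Assignment (suc m)} → f Lifts μ → g Lifts ν →
  f (0F , zero) ≡ g (0F , zero) → ∃ (HalfDifference f g)
halfDifference {m = m} {f} {g} {μ} {ν} f-lifts g-lifts start = (λ v → proj₁ (even v)) , halving λ v → proj₂ (even v)
  where
  open ≡-Reasoning
  even : ∀ v → ∃ λ d → g v ≡ f v + + 2 * d
  even = node-induction (λ v → ∃ λ d → g v ≡ f v + + 2 * d)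
    (0ℤ , trans (sym start) (sym (ℤ.+-identityʳ _)))
    λ e (d , eq) → d + δ (μ e) (ν e) , (begin
      g (target e)                                                   ≡⟨ along g-lifts e ⟩
      g (source e) + ±1 (ν e)                                        ≡⟨ cong₂ _+_ eq (δ-half (μ e) (ν e)) ⟩
      f (source e) + + 2 * d + (±1 (μ e) + + 2 * δ (μ e) (ν e))      ≡⟨ regroup (f (source e)) d (±1 (μ e)) (δ (μ e) (ν e)) ⟩
      f (source e) + ±1 (μ e) + + 2 * (d + δ (μ e) (ν e))            ≡⟨ cong (_+ _) (along f-lifts e) ⟨
      f (target e) + + 2 * (d + δ (μ e) (ν e))                       ∎)

halfDifference-step : ∀ {f g D} {μ ν : Assignment (suc m)} → f Lifts μ → g Lifts ν →
  HalfDifference f g D → ∀ e → D (target e) ≡ D (source e) + δ (μ e) (ν e)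
halfDifference-step {f = f} {g} {D} {μ} {ν} f-lifts g-lifts half e =
  ℤ.*-cancelˡ-≡ (+ 2) _ _ $ +-cancelˡ (f (target e)) _ _ $ begin
    f (target e) + + 2 * D (target e)                                  ≡⟨ at half (target e) ⟨
    g (target e)                                                       ≡⟨ along g-lifts e ⟩
    g (source e) + ±1 (ν e)                                            ≡⟨ cong₂ _+_ (at half (source e)) (δ-half (μ e) (ν e)) ⟩
    f (source e) + + 2 * D (source e) + (±1 (μ e) + + 2 * δ (μ e) (ν e)) ≡⟨ regroup (f (source e)) (D (source e)) (±1 (μ e)) (δ (μ e) (ν e)) ⟩
    f (source e) + ±1 (μ e) + + 2 * (D (source e) + δ (μ e) (ν e))     ≡⟨ cong (_+ _) (along f-lifts e) ⟨
    f (target e) + + 2 * (D (source e) + δ (μ e) (ν e))                ∎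
  where
  open ≡-Reasoning

-- Face flips as moves of local extrema

_≟ₙ_ : (u v : Node n) → Dec (u ≡ v)
_≟ₙ_ = ≡-dec Fin._≟_ Fin._≟_

source≢target : (e : Crease (suc m)) → source e ≢ target e
source≢target (vertical 0F k) eq = inject₁≢suc k (cong proj₂ eq)
source≢target (vertical 1F k) eq = inject₁≢suc k (cong proj₂ (sym eq))

source-borders : (e : Crease (suc m)) → Borders e (source e)
source-borders (horizontal j)  = refl
source-borders (vertical 0F k) = refl , inj₁ refl
source-borders (vertical 1F k) = refl , inj₂ refl

target-borders : (e : Crease (suc m)) → Borders e (target e)
target-borders (horizontal j)  = refl
target-borders (vertical 0F k) = refl , inj₂ refl
target-borders (vertical 1F k) = refl , inj₁ refl

borders⇒endpoint : (e : Crease (suc m)) (α : Face (suc m)) → Borders e α → source e ≡ α ⊎ target e ≡ α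
borders⇒endpoint (horizontal j)  (0F , _) refl               = inj₁ refl
borders⇒endpoint (horizontal j)  (1F , _) refl               = inj₂ refl
borders⇒endpoint (vertical 0F k) (_  , _) (refl , inj₁ refl) = inj₁ refl
borders⇒endpoint (vertical 0F k) (_  , _) (refl , inj₂ refl) = inj₂ refl
borders⇒endpoint (vertical 1F k) (_  , _) (refl , inj₁ refl) = inj₂ refl
borders⇒endpoint (vertical 1F k) (_  , _) (refl , inj₂ refl) = inj₁ refl

flip-on : (μ : Assignment n) (α : Face n) (e : Crease n) → Borders e α → flip μ α e ≡ opposite (μ e)
flip-on μ α e b rewrite dec-true (borders? e α) b = refl

flip-off : (μ : Assignment n) (α : Face n) (e : Crease n) → ¬ Borders e α → flip μ α e ≡ μ e
flip-off μ α e ¬b rewrite dec-false (borders? e α) ¬b = refl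

-- Extremum μ α ⊕ and Extremum μ α ⊖ say that the heights lifting μ have a local minimum,
-- respectively a local maximum, at α.
Extremum : Assignment (suc m) → Face (suc m) → Sign → Set
Extremum μ α s = ∀ e → (source e ≡ α → μ e ≡ s) × (target e ≡ α → μ e ≡ opposite s)

point : Node n → ℤ → Node n → ℤ
point α x v = if does (v ≟ₙ α) then x else 0ℤ

point-on : (α : Node n) (x : ℤ) (v : Node n) → v ≡ α → point α x v ≡ x
point-on α x v eq rewrite dec-true (v ≟ₙ α) eq = refl

point-off : (α : Node n) (x : ℤ) (v : Node n) → v ≢ α → point α x v ≡ 0ℤ
point-off α x v neq rewrite dec-false (v ≟ₙ α) neq = refl

bump : (Node n → ℤ) → Node n → Sign → Node n → ℤ
bump f α s v = f v + + 2 * point α (±1 s) v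

-- At a minimum all neighbours lie one higher; raising the node by 2 leaves them one lower, which
-- negates exactly the bordering creases. Maxima are dual.
bump-lifts : ∀ {f} {μ : Assignment (suc m)} {α s} → f Lifts μ → Extremum μ α s →
  bump f α s Lifts flip μ α
bump-lifts {f = f} {μ} {α} {s} lifts extremum = lifting along-flip
  where
  on-source : ∀ a x → a + x + + 2 * 0ℤ ≡ a + + 2 * x + - x
  on-source = solve-∀
  on-target : ∀ a x → a + - x + + 2 * x ≡ a + + 2 * 0ℤ + x
  on-target = solve-∀
  off : ∀ a x → a + x + + 2 * 0ℤ ≡ a + + 2 * 0ℤ + x
  off = solve-∀
  along-flip : ∀ e → bump f α s (target e) ≡ bump f α s (source e) + ±1 (flip μ α e)
  along-flip e with source e ≟ₙ α | target e ≟ₙ α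
  ... | yes src≡ | yes tgt≡ = contradiction (trans src≡ (sym tgt≡)) (source≢target e)
  ... | yes src≡ | no  _
    rewrite flip-on μ α e (subst (Borders e) src≡ (source-borders e))
          | along lifts e | proj₁ (extremum e) src≡ | ±1-opposite s = on-source (f (source e)) (±1 s)
  ... | no  _    | yes tgt≡
    rewrite flip-on μ α e (subst (Borders e) tgt≡ (target-borders e))
          | along lifts e | proj₂ (extremum e) tgt≡ | Sign.opposite-involutive s | ±1-opposite s = on-target (f (source e)) (±1 s)
  ... | no  src≢ | no  tgt≢
    rewrite flip-off μ α e ([ src≢ , tgt≢ ]′ ∘ borders⇒endpoint e α) | along lifts e = off (f (source e)) (±1 (μ e))

conserves-at : (μ : Assignment (suc m)) → LocallyValid μ → ∀ k {l t r b} →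
  μ (horizontal (inject₁ k)) ≡ l → μ (vertical 0F k) ≡ t →
  μ (horizontal (suc k)) ≡ r → μ (vertical 1F k) ≡ b → Conserves l t r b
conserves-at μ valid k refl refl refl refl = valid⇒conserved μ valid k

-- The horizontal crease fixes the kind of extremum, and the corner lemmas at the interior vertices
-- on either side tie the vertical creases to it. In the bottom row they apply after exchanging top
-- and bottom, and the sign is opposite because the horizontal crease ends there.
flippable⇒extremum : (μ : Assignment (suc m)) (α : Face (suc m)) → Flippable μ α → ∃ (Extremum μ α)
flippable⇒extremum μ α@(0F , j) (valid , valid′) = μ (horizontal j) , λ
  { (horizontal _)  → (λ { refl → refl }) , λ ()
  ; (vertical 0F k) →
      (λ { refl → left-corner (valid⇒conserved μ valid k) (conserves-at (flip μ α) valid′ k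
        (flip-on μ α _ refl) (flip-on μ α (vertical 0F k) (refl , inj₁ refl))
        (flip-off μ α (horizontal (suc k)) (inject₁≢suc k ∘ sym)) refl) }) ,
      (λ { refl → right-corner (valid⇒conserved μ valid k) (conserves-at (flip μ α) valid′ k
        (flip-off μ α (horizontal (inject₁ k)) (inject₁≢suc k)) (flip-on μ α (vertical 0F k) (refl , inj₂ refl))
        (flip-on μ α (horizontal (suc k)) refl) refl) })
  ; (vertical 1F k) → (λ ()) , λ ()
  }
flippable⇒extremum μ α@(1F , j) (valid , valid′) = opposite (μ (horizontal j)) , λ
  { (horizontal _)  → (λ ()) , λ { refl → sym (Sign.opposite-involutive _) }
  ; (vertical 0F k) → (λ ()) , λ ()
  ; (vertical 1F k) →
      (λ { refl → right-corner (conserves-swap (valid⇒conserved μ valid k)) (conserves-swap (conserves-at (flip μ α) valid′ k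
        (flip-off μ α (horizontal (inject₁ k)) (inject₁≢suc k)) refl
        (flip-on μ α (horizontal (suc k)) refl) (flip-on μ α (vertical 1F k) (refl , inj₂ refl)))) }) ,
      (λ { refl → trans (left-corner (conserves-swap (valid⇒conserved μ valid k)) (conserves-swap (conserves-at (flip μ α) valid′ k
        (flip-on μ α (horizontal (inject₁ k)) refl) refl
        (flip-off μ α (horizontal (suc k)) (inject₁≢suc k ∘ sym)) (flip-on μ α (vertical 1F k) (refl , inj₁ refl)))))
        (sym (Sign.opposite-involutive _)) })
  }

-- Sums over the nodes

sum-mono : {f g : Fin n → ℕ} → (∀ i → f i ℕ.≤ g i) → sum f ℕ.≤ sum g
sum-mono {zero}  f≤g = z≤n
sum-mono {suc n} f≤g = ℕ.+-mono-≤ (f≤g zero) (sum-mono (f≤g ∘ suc))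

term≤sum : (f : Fin n → ℕ) (i : Fin n) → f i ℕ.≤ sum f
term≤sum f zero    = ℕ.m≤m+n _ _
term≤sum f (suc i) = ℕ.≤-trans (term≤sum (f ∘ suc) i) (ℕ.m≤n+m _ (f zero))

sum-zero : (f : Fin n → ℕ) → (∀ i → f i ≡ 0) → sum f ≡ 0
sum-zero {zero}  f f≡0 = refl
sum-zero {suc n} f f≡0 = cong₂ ℕ._+_ (f≡0 zero) (sum-zero (f ∘ suc) (f≡0 ∘ suc))

sum-single : (f : Fin n → ℕ) (i : Fin n) → (∀ j → j ≢ i → f j ≡ 0) → sum f ≡ f i
sum-single f zero    off = trans (cong (f zero ℕ.+_) (sum-zero (f ∘ suc) λ j → off (suc j) λ ())) (ℕ.+-identityʳ _)
sum-single f (suc i) off = cong₂ ℕ._+_ (off zero λ ()) (sum-single (f ∘ suc) i λ j j≢i → off (suc j) (j≢i ∘ Fin.suc-injective))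

sum-positive : {N : ℕ} (f : Fin n → ℕ) → sum f ≡ suc N → ∃ λ i → f i ≢ 0
sum-positive {suc n} f eq with f zero in f0≡
... | suc _ = zero , λ f0≡0 → contradiction (trans (sym f0≡) f0≡0) λ ()
... | zero  = let i , fi≢0 = sum-positive (f ∘ suc) eq in suc i , fi≢0

∑-cong : {f g : Node n → ℕ} → f ≗ g → ∑ f ≡ ∑ g
∑-cong f≗g = sum-cong-≗ λ i → sum-cong-≗ λ j → f≗g (i , j)

∑-zero : {f : Node n → ℕ} → (∀ v → f v ≡ 0) → ∑ f ≡ 0
∑-zero {f = f} f≡0 = sum-zero (λ i → sum λ j → f (i , j)) λ i → sum-zero (λ j → f (i , j)) λ j → f≡0 (i , j)

∑-mono : {f g : Node n → ℕ} → (∀ v → f v ℕ.≤ g v) → ∑ f ℕ.≤ ∑ g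
∑-mono f≤g = sum-mono λ i → sum-mono λ j → f≤g (i , j)

∑-+ : (f g : Node n → ℕ) → ∑ (λ v → f v ℕ.+ g v) ≡ ∑ f ℕ.+ ∑ g
∑-+ f g = trans (sum-cong-≗ λ i → ∑-distrib-+ (λ j → f (i , j)) (λ j → g (i , j)))
                (∑-distrib-+ (λ i → sum λ j → f (i , j)) (λ i → sum λ j → g (i , j)))

term≤∑ : (f : Node n → ℕ) (v : Node n) → f v ℕ.≤ ∑ f
term≤∑ f (i , j) = ℕ.≤-trans (term≤sum (λ j → f (i , j)) j) (term≤sum (λ i → sum λ j → f (i , j)) i)

∑-positive : {N : ℕ} (f : Node n → ℕ) → ∑ f ≡ suc N → ∃ λ v → f v ≢ 0
∑-positive {N = N} f eq with sum-positive (λ i → sum λ j → f (i , j)) eq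
... | i , row≢0 with sum (λ j → f (i , j)) in row≡
...   | zero  = contradiction refl row≢0
...   | suc _ = let j , fij≢0 = sum-positive (λ j → f (i , j)) row≡ in (i , j) , fij≢0

∑-point : (α : Node n) (x : ℤ) → ∑ (λ v → ∣ point α x v ∣) ≡ ∣ x ∣
∑-point α@(i , j) x = begin
  ∑ (λ v → ∣ point α x v ∣)
    ≡⟨ sum-single (λ i′ → sum λ j′ → ∣ point α x (i′ , j′) ∣) i (λ i′ i′≢i → sum-zero (λ j′ → ∣ point α x (i′ , j′) ∣) λ j′ →
         cong ∣_∣ (point-off α x (i′ , j′) (i′≢i ∘ cong proj₁))) ⟩
  sum (λ j′ → ∣ point α x (i , j′) ∣)
    ≡⟨ sum-single (λ j′ → ∣ point α x (i , j′) ∣) j (λ j′ j′≢j → cong ∣_∣ (point-off α x (i , j′) (j′≢j ∘ cong proj₂))) ⟩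
  ∣ point α x α ∣
    ≡⟨ cong ∣_∣ (point-on α x α refl) ⟩
  ∣ x ∣ ∎
  where open ≡-Reasoning

-- Descent towards a target height

±1*±1 : ∀ s → ±1 s * ±1 s ≡ 1ℤ
±1*±1 ⊕ = refl
±1*±1 ⊖ = refl

±1*±1-opposite : ∀ s → ±1 s * ±1 (opposite s) ≡ -1ℤ
±1*±1-opposite ⊕ = refl
±1*±1-opposite ⊖ = refl

-- Where `f` steps by `opposite s`, the step of `g` is at least as far in the direction `s`, so `D`
-- loses no ground in that direction. The next lemma is the same fact for an edge traversed
-- backwards.
0≤±1*δ-opposite : ∀ s t → 0ℤ ℤ.≤ ±1 s * δ (opposite s) t
0≤±1*δ-opposite ⊕ ⊕ = ℤ.+≤+ z≤n
0≤±1*δ-opposite ⊕ ⊖ = ℤ.+≤+ z≤n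
0≤±1*δ-opposite ⊖ ⊕ = ℤ.+≤+ z≤n
0≤±1*δ-opposite ⊖ ⊖ = ℤ.+≤+ z≤n

0≤-±1*δ : ∀ s t → 0ℤ ℤ.≤ - (±1 s * δ s t)
0≤-±1*δ ⊕ ⊕ = ℤ.+≤+ z≤n
0≤-±1*δ ⊕ ⊖ = ℤ.+≤+ z≤n
0≤-±1*δ ⊖ ⊕ = ℤ.+≤+ z≤n
0≤-±1*δ ⊖ ⊖ = ℤ.+≤+ z≤n

-- Among the nodes where g exceeds f, one where f is lowest is a local minimum of f:
-- a lower neighbour would again be a node where g exceeds f.
descend : ∀ {f g D} {μ ν : Assignment (suc m)} → f Lifts μ → g Lifts ν → HalfDifference f g D →
  ∀ s v → 0ℤ ℤ.< ±1 s * D v → ∃ λ α → 0ℤ ℤ.< ±1 s * D α × Extremum μ α s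
descend {m} {f} {g} {D} {μ} {ν} f-lifts g-lifts half s v pos = α , pos-α , λ e → at-source e , at-target e
  where
  Positive : Node (suc m) → Set
  Positive u = 0ℤ ℤ.< ±1 s * D u

  positive? : ∀ u → Dec (Positive u)
  positive? u = 0ℤ ℤ.<? ±1 s * D u

  -- Multiplying by `±1 s` turns a highest node into a lowest one when `s` is negative, so one
  -- argument covers both directions.
  h : Node (suc m) → ℤ
  h u = ±1 s * f u

  nodes candidates : List (Node (suc m))
  nodes = cartesianProduct (allFin 2) (allFin (suc m))
  candidates = filter positive? nodes

  α : Node (suc m)
  -- The default `v` is positive by hypothesis, so the chosen node is positive in any case.
  α = argmin h v candidates

  pos-α : Positive α
  pos-α = argmin-all h {xs = candidates} pos (all-filter positive? nodes)

  not-lower : ∀ {u} → Positive u → ¬ (h u + 1ℤ ≡ h α)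
  not-lower {u} pos-u eq = ℤ.<⇒≱ (subst₂ ℤ._<_ (ℤ.+-identityʳ (h u)) eq (ℤ.+-monoʳ-< (h u) {0ℤ} {1ℤ} (ℤ.+<+ (s≤s z≤n))))
    (All.lookup (f[argmin]≤f[xs] {f = h} v candidates)
      (∈-filter⁺ positive? (∈-cartesianProduct⁺ (∈-allFin (proj₁ u)) (∈-allFin (proj₂ u))) pos-u))

  step-D : ∀ e → D (target e) ≡ D (source e) + δ (μ e) (ν e)
  step-D = halfDifference-step f-lifts g-lifts half

  at-source : ∀ e → source e ≡ α → μ e ≡ s
  at-source e src≡ = [ id , (λ μe≡ → contradiction (lower μe≡) (not-lower (pos-target μe≡))) ]′ (sign-dichotomy (μ e) s)
    where
    expand : ∀ x a b → x * (a + b) + 1ℤ ≡ x * a + (x * b + 1ℤ)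
    expand = solve-∀
    lower : μ e ≡ opposite s → h (target e) + 1ℤ ≡ h α
    lower μe≡ = begin
      ±1 s * f (target e) + 1ℤ                          ≡⟨ cong (λ x → ±1 s * x + 1ℤ) (along f-lifts e) ⟩
      ±1 s * (f (source e) + ±1 (μ e)) + 1ℤ             ≡⟨ cong (λ t → ±1 s * (f (source e) + ±1 t) + 1ℤ) μe≡ ⟩
      ±1 s * (f (source e) + ±1 (opposite s)) + 1ℤ      ≡⟨ expand (±1 s) (f (source e)) (±1 (opposite s)) ⟩
      h (source e) + (±1 s * ±1 (opposite s) + 1ℤ)      ≡⟨ cong (λ x → h (source e) + (x + 1ℤ)) (±1*±1-opposite s) ⟩
      h (source e) + 0ℤ                                 ≡⟨ ℤ.+-identityʳ _ ⟩
      h (source e)                                      ≡⟨ cong h src≡ ⟩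
      h α                                               ∎
      where open ≡-Reasoning
    pos-target : μ e ≡ opposite s → Positive (target e)
    pos-target μe≡ = subst (0ℤ ℤ.<_)
      (sym (trans (cong (±1 s *_) (trans (step-D e) (cong (λ t → D (source e) + δ t (ν e)) μe≡)))
                  (ℤ.*-distribˡ-+ (±1 s) (D (source e)) (δ (opposite s) (ν e)))))
      (ℤ.+-mono-<-≤ (subst Positive (sym src≡) pos-α) (0≤±1*δ-opposite s (ν e)))

  at-target : ∀ e → target e ≡ α → μ e ≡ opposite s
  at-target e tgt≡ = [ (λ μe≡ → contradiction (lower μe≡) (not-lower (pos-source μe≡))) , id ]′ (sign-dichotomy (μ e) s)
    where
    expand : ∀ x a b → x * a + x * b ≡ x * (a + b)
    expand = solve-∀
    lower : μ e ≡ s → h (source e) + 1ℤ ≡ h α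
    lower refl = begin
      ±1 s * f (source e) + 1ℤ                 ≡⟨ cong (λ x → ±1 s * f (source e) + x) (±1*±1 s) ⟨
      ±1 s * f (source e) + ±1 s * ±1 s        ≡⟨ expand (±1 s) (f (source e)) (±1 s) ⟩
      ±1 s * (f (source e) + ±1 s)             ≡⟨ cong (±1 s *_) (along f-lifts e) ⟨
      h (target e)                             ≡⟨ cong h tgt≡ ⟩
      h α                                      ∎
      where open ≡-Reasoning
    collect : ∀ x a b → x * (a + b) + - (x * b) ≡ x * a
    collect = solve-∀
    pos-source : μ e ≡ s → Positive (source e)
    pos-source refl = subst (0ℤ ℤ.<_)
      (trans (cong (λ x → ±1 s * x + - (±1 s * δ s (ν e))) (step-D e))
             (collect (±1 s) (D (source e)) (δ s (ν e))))
      (ℤ.+-mono-<-≤ (subst Positive (sym tgt≡) pos-α) (0≤-±1*δ s (ν e)))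

-- Walks in the flip graph

positive-multiple : ∀ x → ∣ x ∣ ≢ 0 → ∃ λ s → 0ℤ ℤ.< ±1 s * x
positive-multiple (+ zero)  x≢0 = contradiction refl x≢0
positive-multiple (+ suc k) x≢0 = ⊕ , ℤ.+<+ (s≤s z≤n)
positive-multiple -[1+ k ]  x≢0 = ⊖ , ℤ.+<+ (s≤s z≤n)

∣x∣-decrease : ∀ s x → 0ℤ ℤ.< ±1 s * x → ∣ x ∣ ≡ ∣ x - ±1 s ∣ ℕ.+ ∣ ±1 s ∣
∣x∣-decrease ⊕ (+ zero)     (ℤ.+<+ ())
∣x∣-decrease ⊕ (+ suc k)    _ = ℕ.+-comm 1 k
∣x∣-decrease ⊖ (+ zero)     (ℤ.+<+ ())
∣x∣-decrease ⊖ -[1+ zero ]  _ = refl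
∣x∣-decrease ⊖ -[1+ suc k ] _ = ℕ.+-comm 1 (suc k)

lifts⇒same : ∀ {f g} {μ ν : Assignment (suc m)} → f Lifts μ → g Lifts ν → f ≗ g → μ ≗ ν
lifts⇒same {f = f} {g} {μ} {ν} f-lifts g-lifts f≗g e = ±1-injective $ +-cancelˡ (f (source e)) _ _ $ begin
  f (source e) + ±1 (μ e)  ≡⟨ along f-lifts e ⟨
  f (target e)             ≡⟨ f≗g (target e) ⟩
  g (target e)             ≡⟨ along g-lifts e ⟩
  g (source e) + ±1 (ν e)  ≡⟨ cong (_+ ±1 (ν e)) (f≗g (source e)) ⟨
  f (source e) + ±1 (ν e)  ∎
  where open ≡-Reasoning

-- Induction on the total displacement: `descend` yields an extremum where `D` has the matching
-- sign, and flipping it lowers the total by exactly one. At zero the heights coincide, hence so do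
-- the assignments.
walk-between : ∀ N {f g D} (x y : Vertex (suc m)) → f Lifts proj₁ x → g Lifts proj₁ y →
  HalfDifference f g D → ∑ (λ v → ∣ D v ∣) ≡ N → Walk x y N
walk-between zero {f} {g} {D} x y f-lifts g-lifts half eq = stop (lifts⇒same f-lifts g-lifts λ v →
  sym (trans (at half v) (trans (cong (λ d → f v + + 2 * d) (D≡0 v)) (ℤ.+-identityʳ (f v)))))
  where
  D≡0 : ∀ v → D v ≡ 0ℤ
  D≡0 v = ℤ.∣i∣≡0⇒i≡0 (ℕ.n≤0⇒n≡0 (ℕ.≤-trans (term≤∑ (λ v → ∣ D v ∣) v) (ℕ.≤-reflexive eq)))
walk-between {m} (suc N) {f} {g} {D} x@(μ , valid) y f-lifts g-lifts half eq
  with ∑-positive (λ v → ∣ D v ∣) eq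
... | v , Dv≢0 with positive-multiple (D v) Dv≢0
...   | s , pos with descend f-lifts g-lifts half s v pos
...     | α , pos-α , extremum =
  step {y = flip μ α , valid′} (α , (valid , valid′) , λ _ → refl)
    (walk-between N (flip μ α , valid′) y f′-lifts g-lifts half′ (ℕ.suc-injective (begin
      suc (∑ λ v → ∣ D′ v ∣)                                       ≡⟨ ℕ.+-comm 1 _ ⟩
      ∑ (λ v → ∣ D′ v ∣) ℕ.+ 1                                     ≡⟨ cong (λ k → ∑ (λ v → ∣ D′ v ∣) ℕ.+ k) (trans (∑-point α (±1 s)) (∣±1∣ s)) ⟨
      ∑ (λ v → ∣ D′ v ∣) ℕ.+ ∑ (λ v → ∣ point α (±1 s) v ∣)        ≡⟨ ∑-+ (λ v → ∣ D′ v ∣) (λ v → ∣ point α (±1 s) v ∣) ⟨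
      ∑ (λ v → ∣ D′ v ∣ ℕ.+ ∣ point α (±1 s) v ∣)                  ≡⟨ ∑-cong {f = λ v → ∣ D v ∣} split ⟨
      ∑ (λ v → ∣ D v ∣)                                            ≡⟨ eq ⟩
      suc N                                                        ∎)))
  where
  open ≡-Reasoning
  f′-lifts : bump f α s Lifts flip μ α
  f′-lifts = bump-lifts f-lifts extremum
  valid′ : LocallyValid (flip μ α)
  valid′ = lifts⇒valid f′-lifts
  D′ : Node (suc m) → ℤ
  D′ v = D v - point α (±1 s) v
  half′ : HalfDifference (bump f α s) g D′
  half′ = halving λ v → trans (at half v) (lemma (f v) (D v) (point α (±1 s) v))
    where
    lemma : ∀ a d p → a + + 2 * d ≡ a + + 2 * p + + 2 * (d - p)
    lemma = solve-∀
  split : ∀ v → ∣ D v ∣ ≡ ∣ D′ v ∣ ℕ.+ ∣ point α (±1 s) v ∣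
  split v with v ≟ₙ α
  ... | yes refl = ∣x∣-decrease s (D v) pos-α
  ... | no  _    = sym (trans (ℕ.+-identityʳ _) (cong ∣_∣ (ℤ.+-identityʳ (D v))))

-- The height is carried along the walk. Each flip adds ±1 to the displacement at one node, so by
-- the triangle inequality the total grows by at most one per step.
walk-lifts : ∀ {d f} {x y : Vertex (suc m)} → f Lifts proj₁ x → Walk x y d →
  ∃₂ λ g D → g Lifts proj₁ y × HalfDifference f g D × ∑ (λ v → ∣ D v ∣) ℕ.≤ d
walk-lifts {m} {f = f} f-lifts (stop x≈y) =
  f , (λ _ → 0ℤ) , lifting (λ e → trans (along f-lifts e) (cong (λ s → f (source e) + ±1 s) (x≈y e))) ,
  halving (λ v → sym (ℤ.+-identityʳ (f v))) ,
  ℕ.≤-reflexive (∑-zero {n = suc m} {f = λ _ → 0} λ _ → refl)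
walk-lifts {d = suc d} {f} {μ , _} f-lifts (step {y = ν , _} (α , flippable , ν≗flip) walk)
  with flippable⇒extremum μ α flippable
... | s , extremum
  with walk-lifts {f = bump f α s}
         (lifting λ e → trans (along (bump-lifts f-lifts extremum) e) (cong (λ t → bump f α s (source e) + ±1 t) (sym (ν≗flip e)))) walk
...   | g , D , g-lifts , half , bound =
  g , (λ v → p v + D v) , g-lifts , halving (λ v → trans (at half v) (lemma (f v) (p v) (D v))) , (begin
    ∑ (λ v → ∣ p v + D v ∣)                     ≤⟨ ∑-mono {f = λ v → ∣ p v + D v ∣} (λ v → ℤ.∣i+j∣≤∣i∣+∣j∣ (p v) (D v)) ⟩
    ∑ (λ v → ∣ p v ∣ ℕ.+ ∣ D v ∣)               ≡⟨ ∑-+ (λ v → ∣ p v ∣) (λ v → ∣ D v ∣) ⟩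
    ∑ (λ v → ∣ p v ∣) ℕ.+ ∑ (λ v → ∣ D v ∣)     ≡⟨ cong (λ k → k ℕ.+ ∑ (λ v → ∣ D v ∣)) (trans (∑-point α (±1 s)) (∣±1∣ s)) ⟩
    suc (∑ λ v → ∣ D v ∣)                       ≤⟨ s≤s bound ⟩
    suc d                                       ∎)
  where
  open ℕ.≤-Reasoning
  p = point α (±1 s)
  lemma : ∀ a x y → a + + 2 * x + + 2 * y ≡ a + + 2 * (x + y)
  lemma = solve-∀

-- Distance as the least total displacement

gap : (Node n → ℤ) → ℤ → ℕ
gap D K = ∑ λ v → ∣ K + D v ∣

-- A shift with `∣ K ∣` above `F 0ℤ` cannot beat 0, so a minimum over finitely many candidates is
-- global.
coercive⇒min : (F : ℤ → ℕ) → (∀ K → ∣ K ∣ ℕ.≤ F K) → ∃ λ K₀ → ∀ K → F K₀ ℕ.≤ F K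
coercive⇒min F coercive = K₀ , minimal
  where
  B = F 0ℤ
  candidates : List ℤ
  candidates = map +_ (upTo (suc B)) ++ map (λ k → - (+ k)) (upTo (suc B))
  ∈-candidates : ∀ K → ∣ K ∣ ℕ.≤ B → K ∈ candidates
  ∈-candidates (+ k)    k≤B = ∈-++⁺ˡ (∈-map⁺ +_ (∈-upTo⁺ (s≤s k≤B)))
  ∈-candidates -[1+ k ] k≤B = ∈-++⁺ʳ (map +_ (upTo (suc B))) (∈-map⁺ (λ k → - (+ k)) (∈-upTo⁺ (s≤s k≤B)))
  K₀ : ℤ
  K₀ = ℕExtrema.argmin F 0ℤ candidates
  minimal : ∀ K → F K₀ ℕ.≤ F K
  minimal K with ∣ K ∣ ℕ.≤? B
  ... | yes K≤B = All.lookup (ℕExtrema.f[argmin]≤f[xs] {f = F} 0ℤ candidates) (∈-candidates K K≤B)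
  ... | no  K≰B = ℕ.≤-trans (ℕExtrema.f[argmin]≤f[⊤] {f = F} 0ℤ candidates) (ℕ.≤-trans (ℕ.<⇒≤ (ℕ.≰⇒> K≰B)) (coercive K))

module _ {m : ℕ} {f g D : Node (suc m) → ℤ} {x y : Vertex (suc m)}
         (f-lifts : f Lifts proj₁ x) (g-lifts : g Lifts proj₁ y) (half : HalfDifference f g D) where

  -- Adding 2K to `g` gives another lift of the same assignment and changes `D` to `K + D`.
  gap-walk : ∀ K → Walk x y (gap D K)
  gap-walk K = walk-between (gap D K) x y f-lifts
    (lifting λ e → trans (cong (_+ + 2 * K) (along g-lifts e)) (swap (g (source e)) (±1 (proj₁ y e)) (+ 2 * K)))
    (halving λ v → trans (cong (_+ + 2 * K) (at half v)) (lemma (f v) (D v) K)) refl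
    where
    swap : ∀ a b c → a + b + c ≡ a + c + b
    swap = solve-∀
    lemma : ∀ a d k → a + + 2 * d + + 2 * k ≡ a + + 2 * (k + d)
    lemma = solve-∀

  -- The walk ends in some lift `g′` of the same assignment. Both displacements take the same step
  -- along every crease, so they differ by a constant, the shift `K`.
  walk-gap : ∀ {d} → Walk x y d → ∃ λ K → gap D K ℕ.≤ d
  walk-gap walk with walk-lifts f-lifts walk
  ... | g′ , D′ , g′-lifts , half′ , bound = K , ℕ.≤-trans (ℕ.≤-reflexive (∑-cong {f = λ v → ∣ K + D v ∣} {g = λ v → ∣ D′ v ∣} λ v → cong ∣_∣ (sym (shift v)))) bound
    where
    K = D′ (0F , zero) - D (0F , zero)
    start : ∀ a b → a ≡ a - b + b
    start = solve-∀
    shift : ∀ v → D′ v ≡ K + D v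
    shift = node-induction (λ v → D′ v ≡ K + D v) (start (D′ (0F , zero)) (D (0F , zero))) λ e eq →
      trans (halfDifference-step f-lifts g′-lifts half′ e)
      (trans (cong (_+ _) eq)
      (trans (ℤ.+-assoc K _ _) (cong (λ x → K + x) (sym (halfDifference-step f-lifts g-lifts half e)))))

  gap-distance : ∀ K₀ → (∀ K → gap D K₀ ℕ.≤ gap D K) → IsDistance x y (gap D K₀)
  gap-distance K₀ minimal = gap-walk K₀ , λ d walk → let K , bound = walk-gap walk in ℕ.≤-trans (minimal K) bound

-- Peeling off the outer columns

⌈2k+a/2⌉ : ∀ k a → ⌈ k ℕ.* 2 ℕ.+ a /2⌉ ≡ k ℕ.+ ⌈ a /2⌉
⌈2k+a/2⌉ zero    a = refl
⌈2k+a/2⌉ (suc k) a = cong suc (⌈2k+a/2⌉ k a)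

-- The increment 2n + 2 is what an outer pair of columns contributes, as an upper bound in
-- `two-shifts` (doubled there for the two shifts) and as a lower bound in `staircase-bound`.
⌈[2+n]²/2⌉ : ∀ n → ⌈ (2 ℕ.+ n) ^ 2 /2⌉ ≡ 2 ℕ.* n ℕ.+ 2 ℕ.+ ⌈ n ^ 2 /2⌉
⌈[2+n]²/2⌉ n = trans (cong ⌈_/2⌉ (square n)) (⌈2k+a/2⌉ (2 ℕ.* n ℕ.+ 2) (n ^ 2))
  where
  square : ∀ n → (2 ℕ.+ n) ℕ.* ((2 ℕ.+ n) ℕ.* 1) ≡ (2 ℕ.* n ℕ.+ 2) ℕ.* 2 ℕ.+ n ℕ.* (n ℕ.* 1)
  square = ℕSolver.solve-∀

sum-peel : (f : Fin (2 ℕ.+ n) → ℕ) →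
  sum f ≡ f zero ℕ.+ f (fromℕ (suc n)) ℕ.+ sum (λ j → f (suc (inject₁ j)))
sum-peel {n} f = trans (cong (λ k → f zero ℕ.+ k) (sum-init-last (f ∘ suc)))
  (lemma (f zero) (sum (λ j → f (suc (inject₁ j)))) (f (fromℕ (suc n))))
  where
  lemma : ∀ a b c → a ℕ.+ (b ℕ.+ c) ≡ a ℕ.+ c ℕ.+ b
  lemma = ℕSolver.solve-∀

-- The upper bound

record Close (x y : ℤ) : Set where
  constructor close
  field within : ∣ x - y ∣ ℕ.≤ 1

open Close

close-sym : ∀ {x y} → Close x y → Close y x
close-sym {x} {y} (close x≈y) = close (subst (ℕ._≤ 1) (ℤ.∣i-j∣≡∣j-i∣ x y) x≈y)

-- Indexing the values -1, 0, 1 by `Fin 3` lets claims about small differences be decided by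
-- exhaustion.
unit : Fin 3 → ℤ
unit zero             = -1ℤ
unit (suc zero)       = 0ℤ
unit (suc (suc zero)) = 1ℤ

close⇒unit : ∀ {x y} → Close x y → ∃ λ i → x ≡ y + unit i
close⇒unit {x} {y} (close x≈y) = let i , eq = small (x - y) x≈y in i , trans (restore x y) (cong (λ d → y + d) eq)
  where
  small : ∀ d → ∣ d ∣ ℕ.≤ 1 → ∃ λ i → d ≡ unit i
  small (+ zero)      _ = suc zero , refl
  small (+ suc zero)  _ = suc (suc zero) , refl
  small (+ suc (suc _)) (s≤s ())
  small -[1+ zero ]   _ = zero , refl
  small -[1+ suc _ ]  (s≤s ())
  restore : ∀ x y → x ≡ y + (x - y)
  restore = solve-∀

columnGap : ℤ → ℤ → ℤ → ℕ
columnGap x y K = ∣ K + x ∣ ℕ.+ ∣ K + y ∣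

columnGap-close : ∀ {x x′ y y′} K → Close x x′ → Close y y′ → columnGap x y K ℕ.≤ 2 ℕ.+ columnGap x′ y′ K
columnGap-close {x} {x′} {y} {y′} K x≈x′ y≈y′ = begin
  ∣ K + x ∣ ℕ.+ ∣ K + y ∣                          ≤⟨ ℕ.+-mono-≤ (shift x≈x′) (shift y≈y′) ⟩
  suc ∣ K + x′ ∣ ℕ.+ suc ∣ K + y′ ∣                ≡⟨ cong suc (ℕ.+-suc _ _) ⟩
  2 ℕ.+ columnGap x′ y′ K                          ∎
  where
  open ℕ.≤-Reasoning
  regroup′ : ∀ K x y → K + x ≡ (x - y) + (K + y)
  regroup′ = solve-∀
  shift : ∀ {x y} → Close x y → ∣ K + x ∣ ℕ.≤ suc ∣ K + y ∣
  shift {x} {y} (close x≈y) = begin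
    ∣ K + x ∣                    ≡⟨ cong ∣_∣ (regroup′ K x y) ⟩
    ∣ (x - y) + (K + y) ∣        ≤⟨ ℤ.∣i+j∣≤∣i∣+∣j∣ (x - y) (K + y) ⟩
    ∣ x - y ∣ ℕ.+ ∣ K + y ∣      ≤⟨ ℕ.+-monoˡ-≤ _ x≈y ⟩
    suc ∣ K + y ∣                ∎

-- Up to translation, a 1-Lipschitz square has values 0 and `unit i` in one column, `unit j` and
-- `unit i + unit k` in the other; the hypothesis is its closing edge. The two alternatives are the
-- shifts that cancel the first or the second value of the first column.
square-units : ∀ i j k → ∣ unit i + unit k - unit j ∣ ℕ.≤ 1 →
  (∣ unit i ∣ ℕ.+ (∣ unit j ∣ ℕ.+ ∣ unit i + unit k ∣) ℕ.≤ 2) ⊎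
  (∣ - unit i ∣ ℕ.+ (∣ unit j - unit i ∣ ℕ.+ ∣ unit k ∣) ℕ.≤ 2)
square-units = from-yes (Fin.all? λ i → Fin.all? λ j → Fin.all? λ k →
  (∣ unit i + unit k - unit j ∣ ℕ.≤? 1) →-dec
  ((∣ unit i ∣ ℕ.+ (∣ unit j ∣ ℕ.+ ∣ unit i + unit k ∣) ℕ.≤? 2) ⊎-dec
   (∣ - unit i ∣ ℕ.+ (∣ unit j - unit i ∣ ℕ.+ ∣ unit k ∣) ℕ.≤? 2)))

side-units : ∀ i j k → ∣ unit i + unit k - unit j ∣ ℕ.≤ 1 →
  ∣ unit j ∣ ℕ.+ ∣ unit i + unit k ∣ ℕ.+ (∣ unit j - unit i ∣ ℕ.+ ∣ unit k ∣) ℕ.≤ 4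
side-units = from-yes (Fin.all? λ i → Fin.all? λ j → Fin.all? λ k →
  (∣ unit i + unit k - unit j ∣ ℕ.≤? 1) →-dec
  (∣ unit j ∣ ℕ.+ ∣ unit i + unit k ∣ ℕ.+ (∣ unit j - unit i ∣ ℕ.+ ∣ unit k ∣) ℕ.≤? 4))

-- The total cost of two shifts on one column: bounding it bounds their average, and the choice
-- between them is left to `one-shift`.
pairGap : ℤ → ℤ → ℤ → ℤ → ℕ
pairGap K K′ x y = columnGap x y K ℕ.+ columnGap x y K′

pairGap-close : ∀ {x x′ y y′} K K′ → Close x x′ → Close y y′ → pairGap K K′ x y ℕ.≤ 4 ℕ.+ pairGap K K′ x′ y′
pairGap-close {x} {x′} {y} {y′} K K′ x≈x′ y≈y′ = ℕ.≤-trans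
  (ℕ.+-mono-≤ (columnGap-close K x≈x′ y≈y′) (columnGap-close K′ x≈x′ y≈y′))
  (ℕ.≤-reflexive (lemma (columnGap x′ y′ K) (columnGap x′ y′ K′)))
  where
  lemma : ∀ a b → 2 ℕ.+ a ℕ.+ (2 ℕ.+ b) ≡ 4 ℕ.+ (a ℕ.+ b)
  lemma = ℕSolver.solve-∀

cancel₀ : ∀ x → - x + x ≡ 0ℤ
cancel₀ = solve-∀

cancel₁ : ∀ x i → - x + (x + i) ≡ i
cancel₁ = solve-∀

cancel₂ : ∀ x i k → - x + (x + i + k) ≡ i + k
cancel₂ = solve-∀

cancel₃ : ∀ x i → - (x + i) + x ≡ - i
cancel₃ = solve-∀

cancel₄ : ∀ x i j → - (x + i) + (x + j) ≡ j - i
cancel₄ = solve-∀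

cancel₅ : ∀ x i j k → x + i + k - (x + j) ≡ i + k - j
cancel₅ = solve-∀

square-bound : ∀ {x y z w} → Close y x → Close z x → Close w y → Close w z →
  ∃ λ K → columnGap x y K ℕ.+ columnGap z w K ℕ.≤ 2
square-bound {x} y≈x z≈x w≈y w≈z with close⇒unit y≈x
... | i , refl with close⇒unit z≈x | close⇒unit w≈y
...   | j , refl | k , refl
  with square-units i j k (subst (ℕ._≤ 1) (cong ∣_∣ (cancel₅ x (unit i) (unit j) (unit k))) (within w≈z))
...     | inj₁ bound = - x , subst (ℕ._≤ 2) (sym eq) bound
  where
  eq : columnGap x (x + unit i) (- x) ℕ.+ columnGap (x + unit j) (x + unit i + unit k) (- x)
     ≡ ∣ unit i ∣ ℕ.+ (∣ unit j ∣ ℕ.+ ∣ unit i + unit k ∣)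
  eq rewrite cancel₀ x | cancel₁ x (unit i) | cancel₁ x (unit j) | cancel₂ x (unit i) (unit k) = refl
...     | inj₂ bound = - (x + unit i) , subst (ℕ._≤ 2) (sym eq) bound
  where
  eq : columnGap x (x + unit i) (- (x + unit i)) ℕ.+ columnGap (x + unit j) (x + unit i + unit k) (- (x + unit i))
     ≡ ∣ - unit i ∣ ℕ.+ (∣ unit j - unit i ∣ ℕ.+ ∣ unit k ∣)
  eq rewrite cancel₃ x (unit i) | cancel₀ (x + unit i) | cancel₄ x (unit i) (unit j) | cancel₁ (x + unit i) (unit k)
           | ℕ.+-identityʳ ∣ - unit i ∣ = refl

-- Serves a column next to the middle one of an odd number of columns: cancelling either middle
-- value costs at most 2 here on average.
side-bound : ∀ {x y z w} → Close y x → Close z x → Close w y → Close w z → pairGap (- x) (- y) z w ℕ.≤ 4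
side-bound {x} y≈x z≈x w≈y w≈z with close⇒unit y≈x
... | i , refl with close⇒unit z≈x | close⇒unit w≈y
...   | j , refl | k , refl = subst (ℕ._≤ 4) (sym eq)
  (side-units i j k (subst (ℕ._≤ 1) (cong ∣_∣ (cancel₅ x (unit i) (unit j) (unit k))) (within w≈z)))
  where
  eq : pairGap (- x) (- (x + unit i)) (x + unit j) (x + unit i + unit k)
     ≡ ∣ unit j ∣ ℕ.+ ∣ unit i + unit k ∣ ℕ.+ (∣ unit j - unit i ∣ ℕ.+ ∣ unit k ∣)
  eq rewrite cancel₁ x (unit j) | cancel₂ x (unit i) (unit k)
           | cancel₄ x (unit i) (unit j) | cancel₁ (x + unit i) (unit k) = refl

centre-bound : ∀ {x y} → Close y x → pairGap (- x) (- y) x y ℕ.≤ 2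
centre-bound {x} {y} y≈x = subst (ℕ._≤ 2) (sym eq) (ℕ.+-mono-≤ (within y≈x) (within (close-sym y≈x)))
  where
  eq : pairGap (- x) (- y) x y ≡ ∣ y - x ∣ ℕ.+ ∣ x - y ∣
  eq rewrite cancel₀ x | cancel₀ y | ℕ.+-identityʳ ∣ - y + x ∣ | ℤ.+-comm (- x) y | ℤ.+-comm (- y) x = refl

record LipschitzColumns (a b : Fin (suc n) → ℤ) : Set where
  field
    top-close    : ∀ k → Close (a (suc k)) (a (inject₁ k))
    bottom-close : ∀ k → Close (b (suc k)) (b (inject₁ k))
    column-close : ∀ j → Close (b j) (a j)

open LipschitzColumns

inner : ∀ {a b : Fin (3 ℕ.+ n) → ℤ} → LipschitzColumns a b →
  LipschitzColumns (λ j → a (suc (inject₁ j))) (λ j → b (suc (inject₁ j)))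
inner L = record
  { top-close    = λ k → top-close L (suc (inject₁ k))
  ; bottom-close = λ k → bottom-close L (suc (inject₁ k))
  ; column-close = λ j → column-close L (suc (inject₁ j))
  }

-- Columns are peeled off in pairs, first and last, down to the central 2 or 3 columns, where
-- the shifts K and K′ are chosen.  With three central columns it is not clear in advance which
-- of the two negated values of the middle column is a good shift, but on average they are.
two-shifts : ∀ m (a b : Fin (2 ℕ.+ m) → ℤ) → LipschitzColumns a b → ∃₂ λ K K′ →
  pairGap K K′ (a zero) (b zero) ℕ.+ pairGap K K′ (a (fromℕ (suc m))) (b (fromℕ (suc m))) ℕ.≤ 4 ℕ.* suc m ×
  sum (λ j → pairGap K K′ (a j) (b j)) ℕ.≤ 2 ℕ.* ⌈ (2 ℕ.+ m) ^ 2 /2⌉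
two-shifts zero a b L = K , K , ends , ℕ.≤-trans (ℕ.≤-reflexive (cong (λ k → pairGap K K (a 0F) (b 0F) ℕ.+ k) (ℕ.+-identityʳ _))) ends
  where
  square = square-bound (column-close L 0F) (top-close L 0F) (bottom-close L 0F) (column-close L 1F)
  K = proj₁ square
  lemma : ∀ p q → (p ℕ.+ p) ℕ.+ (q ℕ.+ q) ≡ (p ℕ.+ q) ℕ.+ (p ℕ.+ q)
  lemma = ℕSolver.solve-∀
  ends : pairGap K K (a 0F) (b 0F) ℕ.+ pairGap K K (a 1F) (b 1F) ℕ.≤ 4
  ends = ℕ.≤-trans (ℕ.≤-reflexive (lemma (columnGap (a 0F) (b 0F) K) (columnGap (a 1F) (b 1F) K)))
                   (ℕ.+-mono-≤ (proj₂ square) (proj₂ square))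
-- The two side columns cost at most 8 and the middle one at most 2, and 10 = 2 · ⌈3²/2⌉.
two-shifts (suc zero) a b L = - a 1F , - b 1F , ends , ℕ.≤-trans (ℕ.≤-reflexive (sum-peel S))
    (ℕ.+-mono-≤ ends (ℕ.≤-trans (ℕ.≤-reflexive (ℕ.+-identityʳ (S 1F))) (centre-bound (column-close L 1F))))
  where
  S : Fin 3 → ℕ
  S j = pairGap (- a 1F) (- b 1F) (a j) (b j)
  ends : S zero ℕ.+ S (suc 1F) ℕ.≤ 8
  ends = ℕ.+-mono-≤
    (side-bound (column-close L 1F) (close-sym (top-close L 0F))
      (close-sym (bottom-close L 0F)) (column-close L 0F))
    (side-bound (column-close L 1F) (top-close L 1F) (bottom-close L 1F) (column-close L (suc 1F)))
-- The bound on the two end columns is part of the induction: the next pair outwards exceeds it by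
-- at most 8, one for each of its four nodes and each shift.
two-shifts (suc (suc m)) a b L with two-shifts m (λ j → a (suc (inject₁ j))) (λ j → b (suc (inject₁ j))) (inner L)
... | K , K′ , ends , total = K , K′ , ℕ.≤-trans ends′ (ℕ.≤-reflexive (lemma₂ m)) , (begin
    sum S                                                                       ≡⟨ sum-peel S ⟩
    S zero ℕ.+ S (fromℕ (3 ℕ.+ m)) ℕ.+ sum (λ j → S (suc (inject₁ j)))          ≤⟨ ℕ.+-mono-≤ ends′ total ⟩
    8 ℕ.+ 4 ℕ.* suc m ℕ.+ 2 ℕ.* ⌈ (2 ℕ.+ m) ^ 2 /2⌉                             ≡⟨ lemma₃ m ⌈ (2 ℕ.+ m) ^ 2 /2⌉ ⟩
    2 ℕ.* (2 ℕ.* (2 ℕ.+ m) ℕ.+ 2 ℕ.+ ⌈ (2 ℕ.+ m) ^ 2 /2⌉)                       ≡⟨ cong (2 ℕ.*_) (⌈[2+n]²/2⌉ (2 ℕ.+ m)) ⟨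
    2 ℕ.* ⌈ (4 ℕ.+ m) ^ 2 /2⌉                                                   ∎)
  where
  open ℕ.≤-Reasoning
  S : Fin (4 ℕ.+ m) → ℕ
  S j = pairGap K K′ (a j) (b j)
  last = fromℕ (2 ℕ.+ m)
  lemma₁ : ∀ p q → 4 ℕ.+ p ℕ.+ (4 ℕ.+ q) ≡ 8 ℕ.+ (p ℕ.+ q)
  lemma₁ = ℕSolver.solve-∀
  lemma₂ : ∀ m → 8 ℕ.+ 4 ℕ.* (1 ℕ.+ m) ≡ 4 ℕ.* (3 ℕ.+ m)
  lemma₂ = ℕSolver.solve-∀
  lemma₃ : ∀ m c → 8 ℕ.+ 4 ℕ.* (1 ℕ.+ m) ℕ.+ 2 ℕ.* c ≡ 2 ℕ.* (2 ℕ.* (2 ℕ.+ m) ℕ.+ 2 ℕ.+ c)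
  lemma₃ = ℕSolver.solve-∀
  ends′ : S zero ℕ.+ S (fromℕ (3 ℕ.+ m)) ℕ.≤ 8 ℕ.+ 4 ℕ.* suc m
  ends′ = begin
    S zero ℕ.+ S (suc last)
      ≤⟨ ℕ.+-mono-≤
           (pairGap-close K K′ (close-sym (top-close L zero)) (close-sym (bottom-close L zero)))
           (pairGap-close K K′ (top-close L last) (bottom-close L last)) ⟩
    4 ℕ.+ S 1F ℕ.+ (4 ℕ.+ S (inject₁ last))
      ≡⟨ lemma₁ (S 1F) (S (inject₁ last)) ⟩
    8 ℕ.+ (S 1F ℕ.+ S (inject₁ last))
      ≤⟨ ℕ.+-monoʳ-≤ 8 ends ⟩
    8 ℕ.+ 4 ℕ.* suc m ∎

halve-≤ : ∀ a b {c} → a ℕ.+ b ℕ.≤ 2 ℕ.* c → a ℕ.≤ c ⊎ b ℕ.≤ c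
halve-≤ a b {c} a+b≤2c with ℕ.≤-total a b
... | inj₁ a≤b = inj₁ (ℕ.*-cancelˡ-≤ 2 (ℕ.≤-trans (ℕ.+-monoʳ-≤ a (ℕ.≤-trans (ℕ.≤-reflexive (ℕ.+-identityʳ a)) a≤b)) a+b≤2c))
... | inj₂ b≤a = inj₂ (ℕ.*-cancelˡ-≤ 2 (ℕ.≤-trans (ℕ.+-mono-≤ b≤a (ℕ.≤-reflexive (ℕ.+-identityʳ b))) a+b≤2c))

-- Two shifts with total cost at most twice the bound cannot both exceed it.
one-shift : ∀ m (a b : Fin (2 ℕ.+ m) → ℤ) → LipschitzColumns a b →
  ∃ λ K → sum (λ j → columnGap (a j) (b j) K) ℕ.≤ ⌈ (2 ℕ.+ m) ^ 2 /2⌉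
one-shift m a b L with two-shifts m a b L
... | K , K′ , _ , total with halve-≤ (sum (C K)) (sum (C K′)) {⌈ (2 ℕ.+ m) ^ 2 /2⌉} (subst (ℕ._≤ 2 ℕ.* ⌈ (2 ℕ.+ m) ^ 2 /2⌉) (∑-distrib-+ (C K) (C K′)) total)
  where
  C : ℤ → Fin (2 ℕ.+ m) → ℕ
  C K j = columnGap (a j) (b j) K
...   | inj₁ bound = K , bound
...   | inj₂ bound = K′ , bound

-- The lower bound for staircases

-- For `∣ L ∣` ≥ 1 the numbers L + s and L - s do not lie strictly on opposite sides of 0, so their
-- absolute values add up to 2 `∣ L ∣`; here L is `±1 t * + suc n`.
cross-gap : ∀ s t n → ∣ ±1 t * + suc n + ±1 s ∣ ℕ.+ ∣ ±1 t * + suc n - ±1 s ∣ ≡ 2 ℕ.* suc n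
cross-gap s t n = trans (cong (λ x → ∣ x + ±1 s ∣ ℕ.+ ∣ x - ±1 s ∣) (product t)) (signed s t n)
  where
  product : ∀ t → ±1 t * + suc n ≡ t ℤ.◃ suc n
  product ⊕ = ℤ.*-identityˡ (+ suc n)
  product ⊖ = ℤ.-1*i≡-i (+ suc n)
  lemma₁ : ∀ n → suc n ℕ.+ 1 ℕ.+ n ≡ 2 ℕ.* suc n
  lemma₁ = ℕSolver.solve-∀
  lemma₂ : ∀ n → n ℕ.+ (suc n ℕ.+ 1) ≡ 2 ℕ.* suc n
  lemma₂ = ℕSolver.solve-∀
  lemma₃ : ∀ n → n ℕ.+ suc (suc (n ℕ.+ 0)) ≡ 2 ℕ.* suc n
  lemma₃ = ℕSolver.solve-∀
  lemma₄ : ∀ n → suc (suc (n ℕ.+ 0)) ℕ.+ n ≡ 2 ℕ.* suc n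
  lemma₄ = ℕSolver.solve-∀
  signed : ∀ s t n → ∣ (t ℤ.◃ suc n) + ±1 s ∣ ℕ.+ ∣ (t ℤ.◃ suc n) - ±1 s ∣ ≡ 2 ℕ.* suc n
  signed ⊕ ⊕ n       = lemma₁ n
  signed ⊖ ⊕ n       = lemma₂ n
  signed ⊕ ⊖ zero    = refl
  signed ⊕ ⊖ (suc n) = lemma₃ (suc n)
  signed ⊖ ⊖ zero    = refl
  signed ⊖ ⊖ (suc n) = lemma₄ (suc n)

-- The nodes of the end columns are paired crosswise, top with bottom. Paired values differ by L + s
-- and L - s, where `∣ L ∣` is one less than the number of columns, so by `cross-gap` these four
-- nodes cost at least 2 `∣ L ∣` whatever `x` is. The inner columns form a staircase from
-- `x + ±1 t`.
staircase-bound : ∀ n s t x →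
  ⌈ n ^ 2 /2⌉ ℕ.≤ sum {n} λ j → ∣ x + ±1 t * + toℕ j ∣ ℕ.+ ∣ x + ±1 t * + toℕ j + ±1 s ∣
staircase-bound zero       s t x = z≤n
staircase-bound (suc zero) s t x = begin
  1                                                   ≡⟨ ∣±1∣ s ⟨
  ∣ ±1 s ∣                                            ≡⟨ cong ∣_∣ (lemma y (±1 s)) ⟩
  ∣ y + ±1 s - y ∣                                    ≤⟨ ℤ.∣i-j∣≤∣i∣+∣j∣ (y + ±1 s) y ⟩
  ∣ y + ±1 s ∣ ℕ.+ ∣ y ∣                              ≡⟨ ℕ.+-comm (∣ y + ±1 s ∣) (∣ y ∣) ⟩
  ∣ y ∣ ℕ.+ ∣ y + ±1 s ∣                              ≡⟨ ℕ.+-identityʳ _ ⟨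
  ∣ y ∣ ℕ.+ ∣ y + ±1 s ∣ ℕ.+ 0                        ∎
  where
  open ℕ.≤-Reasoning
  y = x + ±1 t * 0ℤ
  lemma : ∀ y s → s ≡ y + s - y
  lemma = solve-∀
staircase-bound (suc (suc n)) s t x = begin
  ⌈ (2 ℕ.+ n) ^ 2 /2⌉                          ≡⟨ ⌈[2+n]²/2⌉ n ⟩
  2 ℕ.* n ℕ.+ 2 ℕ.+ ⌈ n ^ 2 /2⌉                ≡⟨ cong (λ k → k ℕ.+ ⌈ n ^ 2 /2⌉) (double n) ⟩
  2 ℕ.* suc n ℕ.+ ⌈ n ^ 2 /2⌉                  ≤⟨ ℕ.+-mono-≤ ends (staircase-bound n s t (x + ±1 t)) ⟩
  S zero ℕ.+ S last ℕ.+ sum {n} (λ j → ∣ x + ±1 t + ±1 t * + toℕ j ∣ ℕ.+ ∣ x + ±1 t + ±1 t * + toℕ j + ±1 s ∣)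
    ≡⟨ cong (λ k → S zero ℕ.+ S last ℕ.+ k) (sum-cong-≗ {n} λ j → cong (λ y → ∣ y ∣ ℕ.+ ∣ y + ±1 s ∣) (next j)) ⟩
  S zero ℕ.+ S last ℕ.+ sum (λ j → S (suc (inject₁ j)))  ≡⟨ sum-peel S ⟨
  sum S                                        ∎
  where
  open ℕ.≤-Reasoning
  S : Fin (2 ℕ.+ n) → ℕ
  S j = ∣ x + ±1 t * + toℕ j ∣ ℕ.+ ∣ x + ±1 t * + toℕ j + ±1 s ∣
  last = fromℕ (suc n)
  double : ∀ n → 2 ℕ.* n ℕ.+ 2 ≡ 2 ℕ.* (1 ℕ.+ n)
  double = ℕSolver.solve-∀
  shift : ∀ x t k → x + t + t * k ≡ x + t * (+ 1 + k)
  shift = solve-∀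
  next : ∀ j → x + ±1 t + ±1 t * + toℕ j ≡ x + ±1 t * + toℕ (suc (inject₁ j))
  next j = trans (shift x (±1 t) (+ toℕ j)) (cong (λ k → x + ±1 t * + suc k) (sym (Fin.toℕ-inject₁ j)))
  y = x + ±1 t * 0ℤ
  z = x + ±1 t * + suc n
  diff₁ : ∀ x t l s → t * l + s ≡ (x + t * l + s) - (x + t * 0ℤ)
  diff₁ = solve-∀
  diff₂ : ∀ x t l s → t * l - s ≡ (x + t * l) - (x + t * 0ℤ + s)
  diff₂ = solve-∀
  regroup′ : ∀ a b c d → a ℕ.+ b ℕ.+ (c ℕ.+ d) ≡ b ℕ.+ d ℕ.+ (c ℕ.+ a)
  regroup′ = ℕSolver.solve-∀
  ends : 2 ℕ.* suc n ℕ.≤ S zero ℕ.+ S last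
  ends = begin
    2 ℕ.* suc n                                                        ≡⟨ cross-gap s t n ⟨
    ∣ ±1 t * + suc n + ±1 s ∣ ℕ.+ ∣ ±1 t * + suc n - ±1 s ∣            ≡⟨ cong₂ (λ u v → ∣ u ∣ ℕ.+ ∣ v ∣) (diff₁ x (±1 t) (+ suc n) (±1 s)) (diff₂ x (±1 t) (+ suc n) (±1 s)) ⟩
    ∣ z + ±1 s - y ∣ ℕ.+ ∣ z - (y + ±1 s) ∣                            ≤⟨ ℕ.+-mono-≤ (ℤ.∣i-j∣≤∣i∣+∣j∣ (z + ±1 s) y) (ℤ.∣i-j∣≤∣i∣+∣j∣ z (y + ±1 s)) ⟩
    ∣ z + ±1 s ∣ ℕ.+ ∣ y ∣ ℕ.+ (∣ z ∣ ℕ.+ ∣ y + ±1 s ∣)                ≡⟨ regroup′ (∣ z + ±1 s ∣) (∣ y ∣) (∣ z ∣) (∣ y + ±1 s ∣) ⟩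
    ∣ y ∣ ℕ.+ ∣ y + ±1 s ∣ ℕ.+ (∣ z ∣ ℕ.+ ∣ z + ±1 s ∣)                ≡⟨ cong (λ k → S zero ℕ.+ (∣ x + ±1 t * + k ∣ ℕ.+ ∣ x + ±1 t * + k + ±1 s ∣)) (Fin.toℕ-fromℕ (suc n)) ⟨
    S zero ℕ.+ S last                                                  ∎

-- Colourings

colouring : (Node n → ℤ) → Coloring n
colouring f v = fromℕ< (n%ℕd<d (f v) 3)

colouring-lift : (f : Node n → ℤ) (v : Node n) → f v ≡ color (colouring f) v + (f v /ℕ 3) * + 3
colouring-lift f v = trans (a≡a%ℕn+[a/ℕn]*n (f v) 3)
  (cong (λ r → + r + (f v /ℕ 3) * + 3) (sym (Fin.toℕ-fromℕ< (n%ℕd<d (f v) 3))))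

colouring-step : ∀ {f} {μ : Assignment (suc m)} → f Lifts μ → ∀ e →
  color (colouring f) (target e) ≡₃ color (colouring f) (source e) + ±1 (μ e)
colouring-step {f = f} {μ} lifts e = ∣⇒∣ᵤ (divides (p - q) (begin
  b - (a + x)                          ≡⟨ lemma a b p q x ⟩
  b + q * + 3 - (a + p * + 3 + x) + (p - q) * + 3
    ≡⟨ cong₂ (λ y z → y - (z + x) + (p - q) * + 3) (colouring-lift f (target e)) (colouring-lift f (source e)) ⟨
  f (target e) - (f (source e) + x) + (p - q) * + 3
    ≡⟨ cong (λ y → f (target e) - y + (p - q) * + 3) (along lifts e) ⟨
  f (target e) - f (target e) + (p - q) * + 3
    ≡⟨ cong (_+ (p - q) * + 3) (ℤ.+-inverseʳ (f (target e))) ⟩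
  0ℤ + (p - q) * + 3                   ≡⟨ ℤ.+-identityˡ ((p - q) * + 3) ⟩
  (p - q) * + 3                        ∎))
  where
  open ≡-Reasoning
  a = color (colouring f) (source e)
  b = color (colouring f) (target e)
  p = f (source e) /ℕ 3
  q = f (target e) /ℕ 3
  x = ±1 (μ e)
  lemma : ∀ a b p q x → b - (a + x) ≡ b + q * + 3 - (a + p * + 3 + x) + (p - q) * + 3
  lemma = solve-∀

colouring-corresponds : ∀ {f} {μ : Assignment (suc m)} → f Lifts μ → Corresponds (colouring f) μ
colouring-corresponds lifts =
  (λ k → colouring-step lifts (vertical 0F k)) ,
  (λ j _ → colouring-step lifts (horizontal j)) ,
  (λ k → colouring-step lifts (vertical 1F k))

Residues : Fin 3 → Fin 3 → Sign → Set
Residues a b s = a ≢ b × balanced ((+ toℕ b - + toℕ a) %ℕ 3) ≡ ±1 s × balanced ((+ toℕ a - + toℕ b) %ℕ 3) ≡ - ±1 s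

residues? : ∀ s → Dec ((a b : Fin 3) → + toℕ b ≡₃ + toℕ a + ±1 s → Residues a b s)
residues? s = Fin.all? λ a → Fin.all? λ b → (3 ℕ.∣? ∣ + toℕ b - (+ toℕ a + ±1 s) ∣) →-dec
  (¬? (a Fin.≟ b) ×-dec
   (balanced ((+ toℕ b - + toℕ a) %ℕ 3) ℤ.≟ ±1 s) ×-dec (balanced ((+ toℕ a - + toℕ b) %ℕ 3) ℤ.≟ - ±1 s))

-- Decided over the nine pairs of residues: since 0, 1 and -1 are distinct modulo 3, `balanced`
-- recovers the signed step in either direction.
residues : ∀ s (a b : Fin 3) → + toℕ b ≡₃ + toℕ a + ±1 s → Residues a b s
residues ⊕ = from-yes (residues? ⊕)
residues ⊖ = from-yes (residues? ⊖)

consecutive : (j j′ : Fin (suc m)) → toℕ j′ ≡ suc (toℕ j) → ∃ λ k → inject₁ k ≡ j × suc k ≡ j′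
consecutive j (suc k) eq = k , Fin.toℕ-injective (trans (Fin.toℕ-inject₁ k) (ℕ.suc-injective eq)) , refl

crease-between : {u v : Node (suc m)} → u ∼ v →
  ∃ λ e → (source e ≡ u × target e ≡ v) ⊎ (source e ≡ v × target e ≡ u)
crease-between {u = 0F , j} {0F , j′} (inj₁ (refl , inj₁ eq)) with consecutive j j′ eq
... | k , refl , refl = vertical 0F k , inj₁ (refl , refl)
crease-between {u = 0F , j} {0F , j′} (inj₁ (refl , inj₂ eq)) with consecutive j′ j eq
... | k , refl , refl = vertical 0F k , inj₂ (refl , refl)
crease-between {u = 1F , j} {1F , j′} (inj₁ (refl , inj₁ eq)) with consecutive j j′ eq
... | k , refl , refl = vertical 1F k , inj₂ (refl , refl)
crease-between {u = 1F , j} {1F , j′} (inj₁ (refl , inj₂ eq)) with consecutive j′ j eq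
... | k , refl , refl = vertical 1F k , inj₁ (refl , refl)
crease-between {u = 0F , j} {0F , _} (inj₂ (i≢i , _))  = contradiction refl i≢i
crease-between {u = 0F , j} {1F , _} (inj₂ (_ , refl)) = horizontal j , inj₁ (refl , refl)
crease-between {u = 1F , j} {0F , _} (inj₂ (_ , refl)) = horizontal j , inj₂ (refl , refl)
crease-between {u = 1F , j} {1F , _} (inj₂ (i≢i , _))  = contradiction refl i≢i

module _ {m : ℕ} {f : Node (suc m) → ℤ} {μ : Assignment (suc m)} (lifts : f Lifts μ) where

  private
    residues-along : ∀ e → Residues (colouring f (source e)) (colouring f (target e)) (μ e)
    residues-along e = residues (μ e) (colouring f (source e)) (colouring f (target e)) (colouring-step lifts e)

  colouring-proper : Proper (colouring f)
  colouring-proper u v u∼v with crease-between u∼v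
  ... | e , inj₁ (refl , refl) = proj₁ (residues-along e)
  ... | e , inj₂ (refl , refl) = proj₁ (residues-along e) ∘ sym

  edgeWeight-lift : ∀ {u v} → u ∼ v → edgeWeight (colouring f) u v ≡ f v - f u
  edgeWeight-lift u∼v with crease-between u∼v
  ... | e , inj₁ (refl , refl) = trans (proj₁ (proj₂ (residues-along e)))
    (trans (forward (f (source e)) (±1 (μ e))) (cong (_- f (source e)) (sym (along lifts e))))
    where
    forward : ∀ a x → x ≡ a + x - a
    forward = solve-∀
  ... | e , inj₂ (refl , refl) = trans (proj₂ (proj₂ (residues-along e)))
    (trans (backward (f (source e)) (±1 (μ e))) (cong (λ y → f (source e) - y) (sym (along lifts e))))
    where
    backward : ∀ a x → - x ≡ a - (a + x)
    backward = solve-∀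

  -- Edge weights are height differences and telescope, so only the ends of the path matter.
  pathWeight-lift : ∀ {u v} (p : Path u v) → pathWeight (colouring f) p ≡ f v - f u
  pathWeight-lift {u} ε = sym (ℤ.+-inverseʳ (f u))
  pathWeight-lift {u} {v} (_◅_ {j = w} u∼w p) =
    trans (cong₂ _+_ (edgeWeight-lift u∼w) (pathWeight-lift p)) (telescope (f u) (f w) (f v))
    where
    telescope : ∀ a b c → (b - a) + (c - b) ≡ c - a
    telescope = solve-∀

double-∑ : (F : Node n → ℕ) → ∑ (λ v → 2 ℕ.* F v) ≡ 2 ℕ.* ∑ F
double-∑ F = begin
  ∑ (λ v → 2 ℕ.* F v)        ≡⟨ ∑-cong (λ v → cong (F v ℕ.+_) (ℕ.+-identityʳ (F v))) ⟩
  ∑ (λ v → F v ℕ.+ F v)      ≡⟨ ∑-+ F F ⟩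
  ∑ F ℕ.+ ∑ F                ≡⟨ cong (λ k → ∑ F ℕ.+ k) (ℕ.+-identityʳ (∑ F)) ⟨
  2 ℕ.* ∑ F                  ∎
  where open ≡-Reasoning

module _ {m : ℕ} {f g D : Node (suc m) → ℤ} {μ ν : Assignment (suc m)}
         (f-lifts : f Lifts μ) (g-lifts : g Lifts ν) (half : HalfDifference f g D)
         {u : Node (suc m)} (f≡g : f u ≡ g u) where

  relativeHeight-lift : ∀ {v} (p : Path u v) → relativeHeight (colouring f) (colouring g) p ≡ + 2 * D v
  relativeHeight-lift {v} p = begin
    pathWeight (colouring g) p - pathWeight (colouring f) p  ≡⟨ cong₂ _-_ (pathWeight-lift g-lifts p) (pathWeight-lift f-lifts p) ⟩
    g v - g u - (f v - f u)                                  ≡⟨ cong₂ (λ x y → x - y - (f v - f u)) (at half v) (sym f≡g) ⟩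
    f v + + 2 * D v - f u - (f v - f u)                      ≡⟨ lemma (f v) (f u) (D v) ⟩
    + 2 * D v                                                ∎
    where
    open ≡-Reasoning
    lemma : ∀ a b d → a + + 2 * d - b - (a - b) ≡ + 2 * d
    lemma = solve-∀

  -- Both heights agree at `u`, so the relative height is g - f = 2D, and the even shift 2K yields
  -- twice the gap at `K`.
  relativeHeight-sum : (P : ∀ v → Path u v) → ∀ K →
    ∑ (λ v → ∣ K * + 2 + relativeHeight (colouring f) (colouring g) (P v) ∣) ≡ 2 ℕ.* gap D K
  relativeHeight-sum P K = trans (∑-cong pointwise) (double-∑ (λ v → ∣ K + D v ∣))
    where
    lemma : ∀ k d → k * + 2 + + 2 * d ≡ + 2 * (k + d)
    lemma = solve-∀
    pointwise : ∀ v → ∣ K * + 2 + relativeHeight (colouring f) (colouring g) (P v) ∣ ≡ 2 ℕ.* ∣ K + D v ∣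
    pointwise v = trans (cong (λ h → ∣ K * + 2 + h ∣) (relativeHeight-lift (P v)))
                 (trans (cong ∣_∣ (lemma K (D v))) (ℤ.abs-* (+ 2) (K + D v)))

  halfSum-min : (P : ∀ v → Path u v) → ∀ K₀ {c} → (∀ K → gap D K₀ ℕ.≤ gap D K) → gap D K₀ ℕ.≤ c →
    ∃ λ m → IsMinOver2ℤ (halfSum (colouring f) (colouring g) P) m × m ℚᵘ.≤ (+ c ℚᵘ./ 1)
  halfSum-min P K₀ {c} minimal gap≤c =
    F (K₀ * + 2) , ((K₀ * + 2 , ∣⇒∣ᵤ (divides K₀ refl) , ℚᵘ.≃-refl) , lower) ,
    ℚᵘ.*≤* (subst₂ ℤ._≤_ (sym (ℤ.*-identityʳ _)) (ℤ.pos-* c 2)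
      (ℤ.+≤+ (ℕ.≤-trans (ℕ.≤-reflexive (trans (relativeHeight-sum P K₀) (ℕ.*-comm 2 (gap D K₀)))) (ℕ.*-monoˡ-≤ 2 gap≤c))))
    where
    F = halfSum (colouring f) (colouring g) P
    lower : ∀ H → + 2 ∣ H → F (K₀ * + 2) ℚᵘ.≤ F H
    lower H 2∣H with ∣ᵤ⇒∣ {+ 2} {H} 2∣H
    ... | divides K refl = ℚᵘ.*≤* (ℤ.*-monoʳ-≤-nonNeg (+ 2) (ℤ.+≤+
      (subst₂ ℕ._≤_ (sym (relativeHeight-sum P K₀)) (sym (relativeHeight-sum P K)) (ℕ.*-monoʳ-≤ 2 (minimal K)))))

-- Vertices of degree two

-- The column of a face is read off its horizontal crease. The row needs a vertical crease, on the
-- right of the first column and on the left of any other; two columns guarantee one.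
flip-injective : (μ : Assignment (2 ℕ.+ m)) (α β : Face (2 ℕ.+ m)) → flip μ α ≗ flip μ β → α ≡ β
flip-injective {m} μ α@(i , j) β@(i′ , j′) same = cong₂ _,_ (row j refl) (shared (horizontal j) refl)
  where
  shared : ∀ e → Borders e α → Borders e β
  shared e bα with borders? e β
  ... | yes bβ = bβ
  ... | no ¬bβ = contradiction
    (trans (sym (flip-off μ β e ¬bβ)) (trans (sym (same e)) (flip-on μ α e bα))) (Sign.s≢opposite[s] (μ e))
  row : ∀ j″ → j″ ≡ j → i ≡ i′
  row zero    refl = proj₁ (shared (vertical i zero) (refl , inj₁ refl))
  row (suc k) refl = proj₁ (shared (vertical i k) (refl , inj₂ refl))

-- Distinct faces give distinct neighbours by `flip-injective`, so three of them do not fit into a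
-- list of two.
degree-two-faces : (x : Vertex (2 ℕ.+ m)) → HasDegree x 2 → ∀ α β γ →
  Flippable (proj₁ x) α → Flippable (proj₁ x) β → Flippable (proj₁ x) γ → α ≡ β ⊎ α ≡ γ ⊎ β ≡ γ
degree-two-faces {m} (μ , _) (y₁ ∷ y₂ ∷ [] , _ , adjacent⇔ , refl) α β γ fα fβ fγ =
  pigeonhole (neighbour α fα) (neighbour β fβ) (neighbour γ fγ)
  where
  neighbour : ∀ α → Flippable μ α → flip μ α ≗ proj₁ y₁ ⊎ flip μ α ≗ proj₁ y₂
  neighbour α f with Equivalence.to (adjacent⇔ (flip μ α , proj₂ f)) (α , f , λ _ → refl)
  ... | here eq         = inj₁ eq
  ... | there (here eq) = inj₂ eq
  meet : ∀ {α β} {ν : Assignment (2 ℕ.+ m)} → flip μ α ≗ ν → flip μ β ≗ ν → α ≡ β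
  meet {α} {β} p q = flip-injective μ α β λ e → trans (p e) (sym (q e))
  pigeonhole : flip μ α ≗ proj₁ y₁ ⊎ flip μ α ≗ proj₁ y₂ → flip μ β ≗ proj₁ y₁ ⊎ flip μ β ≗ proj₁ y₂ →
    flip μ γ ≗ proj₁ y₁ ⊎ flip μ γ ≗ proj₁ y₂ → α ≡ β ⊎ α ≡ γ ⊎ β ≡ γ
  pigeonhole (inj₁ p) (inj₁ q) _        = inj₁ (meet p q)
  pigeonhole (inj₂ p) (inj₂ q) _        = inj₁ (meet p q)
  pigeonhole (inj₁ p) (inj₂ q) (inj₁ r) = inj₂ (inj₁ (meet p r))
  pigeonhole (inj₁ p) (inj₂ q) (inj₂ r) = inj₂ (inj₂ (meet q r))
  pigeonhole (inj₂ p) (inj₁ q) (inj₁ r) = inj₂ (inj₂ (meet q r))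
  pigeonhole (inj₂ p) (inj₁ q) (inj₂ r) = inj₂ (inj₁ (meet p r))

-- The conditions read alike in both rows: at the bottom all creases around the face are oriented
-- the other way, which only exchanges minima and maxima.
row-flippable : (μ : Assignment (suc m)) → LocallyValid μ → ∀ i j →
  (∀ k → inject₁ k ≡ j → μ (vertical i k) ≡ μ (horizontal j)) →
  (∀ k → suc k ≡ j → μ (vertical i k) ≡ opposite (μ (horizontal j))) → Flippable μ (i , j)
row-flippable {m} μ valid i j right-crease left-crease =
  valid , lifts⇒valid (bump-lifts (height-lifts μ valid) (extremum i right-crease left-crease))
  where
  s : Fin 2 → Sign
  s 0F = μ (horizontal j)
  s 1F = opposite (μ (horizontal j))
  extremum : ∀ i → (∀ k → inject₁ k ≡ j → μ (vertical i k) ≡ μ (horizontal j)) →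
    (∀ k → suc k ≡ j → μ (vertical i k) ≡ opposite (μ (horizontal j))) → Extremum μ (i , j) (s i)
  extremum 0F r l (horizontal _)  = (λ { refl → refl }) , λ ()
  extremum 0F r l (vertical 0F k) = (λ eq → r k (cong proj₂ eq)) , λ eq → l k (cong proj₂ eq)
  extremum 0F r l (vertical 1F k) = (λ ()) , λ ()
  extremum 1F r l (horizontal _)  = (λ ()) , λ { refl → sym (Sign.opposite-involutive _) }
  extremum 1F r l (vertical 0F k) = (λ ()) , λ ()
  extremum 1F r l (vertical 1F k) = (λ eq → l k (cong proj₂ eq)) ,
    λ eq → trans (r k (cong proj₂ eq)) (sym (Sign.opposite-involutive _))

-- At most one of `t` and `b` differs from `l`, and one that agrees in the first column makes its
-- face there flippable.
left-end : ∀ {l t r b} → Conserves l t r b → t ≡ l ⊎ b ≡ l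
left-end {⊕} {⊕} {⊕} {⊕} (conserves ())
left-end {⊕} {⊕} {⊕} {⊖} _ = inj₁ refl
left-end {⊕} {⊕} {⊖} {⊕} _ = inj₁ refl
left-end {⊕} {⊕} {⊖} {⊖} (conserves ())
left-end {⊕} {⊖} {⊕} {⊕} _ = inj₂ refl
left-end {⊕} {⊖} {⊕} {⊖} (conserves ())
left-end {⊕} {⊖} {⊖} {⊕} (conserves ())
left-end {⊕} {⊖} {⊖} {⊖} (conserves ())
left-end {⊖} {⊕} {⊕} {⊕} (conserves ())
left-end {⊖} {⊕} {⊕} {⊖} (conserves ())
left-end {⊖} {⊕} {⊖} {⊕} (conserves ())
left-end {⊖} {⊕} {⊖} {⊖} _ = inj₂ refl
left-end {⊖} {⊖} {⊕} {⊕} (conserves ())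
left-end {⊖} {⊖} {⊕} {⊖} _ = inj₁ refl
left-end {⊖} {⊖} {⊖} {⊕} _ = inj₁ refl
left-end {⊖} {⊖} {⊖} {⊖} (conserves ())

-- If neither held, all three signs would equal `r` and sum to ±3. At the last vertex, the crease
-- found makes a face of the last column flippable.
right-end : ∀ {l t r b} → Conserves l t r b → t ≡ opposite r ⊎ b ≡ opposite r
right-end {⊕} {⊕} {⊕} {⊕} (conserves ())
right-end {⊕} {⊕} {⊕} {⊖} _ = inj₂ refl
right-end {⊕} {⊕} {⊖} {⊕} _ = inj₁ refl
right-end {⊕} {⊕} {⊖} {⊖} (conserves ())
right-end {⊕} {⊖} {⊕} {⊕} _ = inj₁ refl
right-end {⊕} {⊖} {⊕} {⊖} (conserves ())
right-end {⊕} {⊖} {⊖} {⊕} (conserves ())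
right-end {⊕} {⊖} {⊖} {⊖} (conserves ())
right-end {⊖} {⊕} {⊕} {⊕} (conserves ())
right-end {⊖} {⊕} {⊕} {⊖} (conserves ())
right-end {⊖} {⊕} {⊖} {⊕} (conserves ())
right-end {⊖} {⊕} {⊖} {⊖} _ = inj₁ refl
right-end {⊖} {⊖} {⊕} {⊕} (conserves ())
right-end {⊖} {⊖} {⊕} {⊖} _ = inj₁ refl
right-end {⊖} {⊖} {⊖} {⊕} _ = inj₂ refl
right-end {⊖} {⊖} {⊖} {⊖} (conserves ())

-- When `t` and `b` do not both agree with `l`, one of them is the odd one out, so `r` continues the
-- line.
start-straight : ∀ {l t r b} → Conserves l t r b → ¬ (t ≡ l × b ≡ l) → r ≡ l × b ≡ opposite t
start-straight {⊕} {⊕} {⊕} {⊕} (conserves ()) _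
start-straight {⊕} {⊕} {⊕} {⊖} _ _ = refl , refl
start-straight {⊕} {⊕} {⊖} {⊕} _ ¬both = contradiction (refl , refl) ¬both
start-straight {⊕} {⊕} {⊖} {⊖} (conserves ()) _
start-straight {⊕} {⊖} {⊕} {⊕} _ _ = refl , refl
start-straight {⊕} {⊖} {⊕} {⊖} (conserves ()) _
start-straight {⊕} {⊖} {⊖} {⊕} (conserves ()) _
start-straight {⊕} {⊖} {⊖} {⊖} (conserves ()) _
start-straight {⊖} {⊕} {⊕} {⊕} (conserves ()) _
start-straight {⊖} {⊕} {⊕} {⊖} (conserves ()) _
start-straight {⊖} {⊕} {⊖} {⊕} (conserves ()) _
start-straight {⊖} {⊕} {⊖} {⊖} _ _ = refl , refl
start-straight {⊖} {⊖} {⊕} {⊕} (conserves ()) _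
start-straight {⊖} {⊖} {⊕} {⊖} _ ¬both = contradiction (refl , refl) ¬both
start-straight {⊖} {⊖} {⊖} {⊕} _ _ = refl , refl
start-straight {⊖} {⊖} {⊖} {⊖} (conserves ()) _

-- The two exclusions say that neither face between two consecutive vertices is an extremum. One of
-- `t` and `opposite t` is `opposite s`; the crease after it must then be `opposite s` too, which
-- leaves `s` for the other two.
keep-straight : ∀ {s t t′ r b} → Conserves s t′ r b → ¬ (t ≡ opposite s × t′ ≡ s) →
  ¬ (opposite t ≡ opposite s × b ≡ s) → r ≡ s × t′ ≡ t × b ≡ opposite t
keep-straight {⊕} {⊕} {⊕} {⊕} {⊕} (conserves ()) _ _
keep-straight {⊕} {⊖} {⊕} {⊕} {⊕} (conserves ()) _ _
keep-straight {⊕} {⊕} {⊕} {⊕} {⊖} _ _ _ = refl , refl , refl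
keep-straight {⊕} {⊖} {⊕} {⊕} {⊖} _ ¬top _ = contradiction (refl , refl) ¬top
keep-straight {⊕} {⊕} {⊕} {⊖} {⊕} _ _ ¬bottom = contradiction (refl , refl) ¬bottom
keep-straight {⊕} {⊖} {⊕} {⊖} {⊕} _ ¬top _ = contradiction (refl , refl) ¬top
keep-straight {⊕} {⊕} {⊕} {⊖} {⊖} (conserves ()) _ _
keep-straight {⊕} {⊖} {⊕} {⊖} {⊖} (conserves ()) _ _
keep-straight {⊕} {⊕} {⊖} {⊕} {⊕} _ _ ¬bottom = contradiction (refl , refl) ¬bottom
keep-straight {⊕} {⊖} {⊖} {⊕} {⊕} _ _ _ = refl , refl , refl
keep-straight {⊕} {⊕} {⊖} {⊕} {⊖} (conserves ()) _ _
keep-straight {⊕} {⊖} {⊖} {⊕} {⊖} (conserves ()) _ _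
keep-straight {⊕} {⊕} {⊖} {⊖} {⊕} (conserves ()) _ _
keep-straight {⊕} {⊖} {⊖} {⊖} {⊕} (conserves ()) _ _
keep-straight {⊕} {⊕} {⊖} {⊖} {⊖} (conserves ()) _ _
keep-straight {⊕} {⊖} {⊖} {⊖} {⊖} (conserves ()) _ _
keep-straight {⊖} {⊕} {⊕} {⊕} {⊕} (conserves ()) _ _
keep-straight {⊖} {⊖} {⊕} {⊕} {⊕} (conserves ()) _ _
keep-straight {⊖} {⊕} {⊕} {⊕} {⊖} (conserves ()) _ _
keep-straight {⊖} {⊖} {⊕} {⊕} {⊖} (conserves ()) _ _
keep-straight {⊖} {⊕} {⊕} {⊖} {⊕} (conserves ()) _ _
keep-straight {⊖} {⊖} {⊕} {⊖} {⊕} (conserves ()) _ _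
keep-straight {⊖} {⊕} {⊕} {⊖} {⊖} _ _ _ = refl , refl , refl
keep-straight {⊖} {⊖} {⊕} {⊖} {⊖} _ _ ¬bottom = contradiction (refl , refl) ¬bottom
keep-straight {⊖} {⊕} {⊖} {⊕} {⊕} (conserves ()) _ _
keep-straight {⊖} {⊖} {⊖} {⊕} {⊕} (conserves ()) _ _
keep-straight {⊖} {⊕} {⊖} {⊕} {⊖} _ ¬top _ = contradiction (refl , refl) ¬top
keep-straight {⊖} {⊖} {⊖} {⊕} {⊖} _ _ ¬bottom = contradiction (refl , refl) ¬bottom
keep-straight {⊖} {⊕} {⊖} {⊖} {⊕} _ ¬top _ = contradiction (refl , refl) ¬top
keep-straight {⊖} {⊖} {⊖} {⊖} {⊕} _ _ _ = refl , refl , refl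
keep-straight {⊖} {⊕} {⊖} {⊖} {⊖} (conserves ()) _ _
keep-straight {⊖} {⊖} {⊖} {⊖} {⊖} (conserves ()) _ _

Straight : Assignment (suc m) → Sign → Sign → Set
Straight μ s t = (∀ j → μ (horizontal j) ≡ s) × (∀ k → μ (vertical 0F k) ≡ t)

-- Each end column contains a flippable face, so in degree two no other face is flippable;
-- but wherever the crease signs change from one interior vertex to the next, some face is.
degree-two⇒straight : (x : Vertex (2 ℕ.+ m)) → HasDegree x 2 → ∃₂ (Straight (proj₁ x))
degree-two⇒straight {m} x@(μ , valid) degree = s , t , rows , λ k → proj₁ (proj₂ (straight k))
  where
  s = μ (horizontal zero)
  t = μ (vertical 0F zero)
  conserved = valid⇒conserved μ valid

  first-flippable : ∀ i → μ (vertical i zero) ≡ s → Flippable μ (i , zero)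
  first-flippable i eq = row-flippable μ valid i zero (λ { zero refl → eq }) λ _ ()

  last-flippable : ∀ i → μ (vertical i (fromℕ m)) ≡ opposite (μ (horizontal (fromℕ (suc m)))) →
    Flippable μ (i , fromℕ (suc m))
  last-flippable i eq = row-flippable μ valid i (fromℕ (suc m))
    (λ k last≡ → contradiction (sym last≡) Fin.fromℕ≢inject₁) (λ { _ refl → eq })

  inner-flippable : ∀ i (k : Fin m) → μ (vertical i (inject₁ k)) ≡ opposite (μ (horizontal (suc (inject₁ k)))) →
    μ (vertical i (suc k)) ≡ μ (horizontal (suc (inject₁ k))) → Flippable μ (i , suc (inject₁ k))
  inner-flippable i k left≡ right≡ = row-flippable μ valid i (suc (inject₁ k))
    (λ k′ eq → subst (λ k′ → μ (vertical i k′) ≡ μ (horizontal (suc (inject₁ k)))) (sym (Fin.inject₁-injective {i = k′} {j = suc k} eq)) right≡)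
    (λ { _ refl → left≡ })

  first : ∃ λ i → Flippable μ (i , zero)
  first with left-end (conserved zero)
  ... | inj₁ eq = 0F , first-flippable 0F eq
  ... | inj₂ eq = 1F , first-flippable 1F eq

  last : ∃ λ i → Flippable μ (i , fromℕ (suc m))
  last with right-end (conserved (fromℕ m))
  ... | inj₁ eq = 0F , last-flippable 0F eq
  ... | inj₂ eq = 1F , last-flippable 1F eq

  ¬first-both : ¬ (μ (vertical 0F zero) ≡ s × μ (vertical 1F zero) ≡ s)
  ¬first-both (top , bottom)
    with degree-two-faces x degree (0F , zero) (1F , zero) (proj₁ last , fromℕ (suc m))
           (first-flippable 0F top) (first-flippable 1F bottom) (proj₂ last)
  ... | inj₁ ()
  ... | inj₂ (inj₁ ())
  ... | inj₂ (inj₂ ())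

  ¬inner : ∀ i k → ¬ Flippable μ (i , suc (inject₁ k))
  ¬inner i k flippable with degree-two-faces x degree (proj₁ first , zero) (proj₁ last , fromℕ (suc m)) (i , suc (inject₁ k))
                             (proj₂ first) (proj₂ last) flippable
  ... | inj₁ ()
  ... | inj₂ (inj₁ ())
  ... | inj₂ (inj₂ eq) = Fin.fromℕ≢inject₁ (Fin.suc-injective (cong proj₂ eq))

  StraightAt : Fin (suc m) → Set
  StraightAt k = μ (horizontal (suc k)) ≡ s × μ (vertical 0F k) ≡ t × μ (vertical 1F k) ≡ opposite t

  straight : ∀ k → StraightAt k
  straight = <-weakInduction StraightAt
    (let r≡ , b≡ = start-straight (conserved zero) ¬first-both in r≡ , refl , b≡) next
    where
    next : ∀ k → StraightAt (inject₁ k) → StraightAt (suc k)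
    next k (r≡ , t≡ , b≡) = keep-straight
      (subst (λ l → Conserves l (μ (vertical 0F (suc k))) (μ (horizontal (suc (suc k)))) (μ (vertical 1F (suc k))))
             r≡ (conserved (suc k)))
      (λ (p , q) → ¬inner 0F k (inner-flippable 0F k
        (trans t≡ (trans p (cong opposite (sym r≡)))) (trans q (sym r≡))))
      (λ (p , q) → ¬inner 1F k (inner-flippable 1F k
        (trans b≡ (trans p (cong opposite (sym r≡)))) (trans q (sym r≡))))

  rows : ∀ j → μ (horizontal j) ≡ s
  rows zero    = refl
  rows (suc k) = proj₁ (straight k)

-- Explicit staircase vertices

staircase : Sign → Assignment n
staircase s (horizontal _)  = s
staircase s (vertical 0F _) = s
staircase s (vertical 1F _) = opposite s

staircase-valid : ∀ s → LocallyValid {suc m} (staircase s)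
staircase-valid s = conserved⇒valid (staircase s) λ _ → conserves (balance s)
  where
  balance : ∀ s → ±1 s + ±1 s + ±1 (opposite s) ≡ ±1 s
  balance ⊕ = refl
  balance ⊖ = refl

staircaseVertex : Sign → Vertex (suc m)
staircaseVertex s = staircase s , staircase-valid s

staircase-first : ∀ s → Flippable {suc m} (staircase s) (0F , zero)
staircase-first s = row-flippable (staircase s) (staircase-valid s) 0F zero (λ _ _ → refl) (λ _ ())

staircase-last : ∀ s → Flippable {suc m} (staircase s) (1F , fromℕ m)
staircase-last s = row-flippable (staircase s) (staircase-valid s) 1F (fromℕ _)
  (λ k last≡ → contradiction (sym last≡) Fin.fromℕ≢inject₁) (λ _ _ → refl)

-- The height is monotone rightwards and downwards, so every node other than two opposite corners
-- has both a lower and a higher neighbour.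
staircase-flippable : ∀ s (α : Face (suc m)) → Flippable (staircase s) α →
  α ≡ (0F , zero) ⊎ α ≡ (1F , fromℕ m)
staircase-flippable {m} s α flippable with flippable⇒extremum (staircase s) α flippable
staircase-flippable {m} s (0F , zero)  _ | _ = inj₁ refl
staircase-flippable {m} s (0F , suc k) _ | σ , extremum = contradiction
  (trans (sym (proj₁ (extremum (horizontal (suc k))) refl)) (proj₂ (extremum (vertical 0F k)) refl))
  (Sign.s≢opposite[s] σ)
staircase-flippable {m} s (1F , j)     _ | σ , extremum with m ℕ.≟ toℕ j
... | yes m≡j = inj₂ (cong (1F ,_) (Fin.toℕ-injective (trans (sym m≡j) (sym (Fin.toℕ-fromℕ m)))))
... | no  m≢j = contradiction
  (trans (proj₂ (extremum (horizontal j)) refl)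
         (sym (proj₂ (extremum (vertical 1F (lower₁ j m≢j))) (cong (1F ,_) (Fin.inject₁-lower₁ j m≢j)))))
  (Sign.s≢opposite[s] s)

staircase-degree : ∀ s → HasDegree {2 ℕ.+ m} (staircaseVertex s) 2
staircase-degree {m} s = first ∷ last ∷ [] , (first≉last ∷ []) ∷ [] ∷ [] , (λ y → mk⇔ (to y) (from y)) , refl
  where
  μ : Assignment (2 ℕ.+ m)
  μ = staircase s
  first last : Vertex (2 ℕ.+ m)
  first = flip μ (0F , zero) , proj₂ (staircase-first s)
  last  = flip μ (1F , fromℕ (suc m)) , proj₂ (staircase-last s)
  open Membership (vertexSetoid (2 ℕ.+ m)) using () renaming (_∈_ to _∈ᵥ_)
  first≉last : ¬ (proj₁ first ≗ proj₁ last)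
  first≉last same with flip-injective μ (0F , zero) (1F , fromℕ (suc m)) same
  ... | ()
  to : ∀ y → Adjacent (staircaseVertex s) y → y ∈ᵥ (first ∷ last ∷ [])
  to y (α , flippable , y≗) with staircase-flippable s α flippable
  ... | inj₁ refl = here y≗
  ... | inj₂ refl = there (here y≗)
  from : ∀ y → y ∈ᵥ (first ∷ last ∷ []) → Adjacent (staircaseVertex s) y
  from y (here y≗)         = (0F , zero) , staircase-first s , y≗
  from y (there (here y≗)) = (1F , fromℕ (suc m)) , staircase-last s , y≗

staircase-opposite : ∀ s → Opposite {suc m} (staircase s) (staircase (opposite s))
staircase-opposite s = (λ α → mk⇔ (transfer s (opposite s) α) (transfer (opposite s) s α)) , λ
  { (horizontal _)  → refl
  ; (vertical 0F _) → refl
  ; (vertical 1F _) → refl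
  }
  where
  transfer : ∀ s t α → Flippable (staircase s) α → Flippable (staircase t) α
  transfer s t α flippable with staircase-flippable s α flippable
  ... | inj₁ refl = staircase-first t
  ... | inj₂ refl = staircase-last t

-- Distances

gap-columns : (D : Node n → ℤ) (K : ℤ) →
  gap D K ≡ sum (λ j → columnGap (D (0F , j)) (D (1F , j)) K)
gap-columns D K = trans (cong (λ k → sum (λ j → ∣ K + D (0F , j) ∣) ℕ.+ k) (ℕ.+-identityʳ _))
  (sym (∑-distrib-+ (λ j → ∣ K + D (0F , j) ∣) (λ j → ∣ K + D (1F , j) ∣)))

vertex-lifts : (x : Vertex (suc m)) → height (proj₁ x) Lifts proj₁ x
vertex-lifts (μ , valid) = height-lifts μ valid

module _ {m : ℕ} (x y : Vertex (2 ℕ.+ m)) where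

  private
    μ = proj₁ x
    ν = proj₁ y
    displacement : ∃ (HalfDifference (height μ) (height ν))
    displacement = halfDifference (vertex-lifts x) (vertex-lifts y) refl
    D = proj₁ displacement

  half : HalfDifference (height μ) (height ν) D
  half = proj₂ displacement

  D-step : ∀ e → D (target e) ≡ D (source e) + δ (μ e) (ν e)
  D-step = halfDifference-step (vertex-lifts x) (vertex-lifts y) half

  D-lipschitz : LipschitzColumns (λ j → D (0F , j)) (λ j → D (1F , j))
  D-lipschitz = record
    { top-close    = λ k → close-step (vertical 0F k)
    ; bottom-close = λ k → close-sym (close-step (vertical 1F k))
    ; column-close = λ j → close-step (horizontal j)
    }
    where
    lemma : ∀ a d → a + d - a ≡ d
    lemma = solve-∀
    close-step : ∀ e → Close (D (target e)) (D (source e))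
    close-step e = close (subst (ℕ._≤ 1)
      (cong ∣_∣ (sym (trans (cong (_- D (source e)) (D-step e)) (lemma (D (source e)) (δ (μ e) (ν e))))))
      (∣δ∣≤1 (μ e) (ν e)))

  D-origin : D (0F , zero) ≡ 0ℤ
  D-origin = ℤ.*-cancelˡ-≡ (+ 2) _ _ (sym (trans (at half (0F , zero)) (ℤ.+-identityˡ _)))

  -- The top-left node, where `D` vanishes, contributes `∣ K ∣` to the gap; this is the coercivity
  -- that yields a minimum.
  gap-min : ∃ λ K₀ → ∀ K → gap D K₀ ℕ.≤ gap D K
  gap-min = coercive⇒min (gap D) λ K → ℕ.≤-trans
    (ℕ.≤-reflexive (cong ∣_∣ (sym (trans (cong (λ d → K + d) D-origin) (ℤ.+-identityʳ K)))))
    (term≤∑ (λ v → ∣ K + D v ∣) (0F , zero))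

  private K₀ = proj₁ gap-min

  gap-min-bound : gap D K₀ ℕ.≤ ⌈ (2 ℕ.+ m) ^ 2 /2⌉
  gap-min-bound = let K , bound = one-shift m _ _ D-lipschitz in
    ℕ.≤-trans (proj₂ gap-min K) (ℕ.≤-trans (ℕ.≤-reflexive (gap-columns D K)) bound)

  distance : IsDistance x y (gap D K₀)
  distance = gap-distance (vertex-lifts x) (vertex-lifts y) half K₀ (proj₂ gap-min)

  -- Opposite signs make `D` step by `opposite (μ e)` along each crease, so `K + D` is itself a
  -- staircase and `staircase-bound` applies to every `K`.
  straight-opposite-gap : ∀ {s t} → Straight μ s t → (∀ e → ν e ≡ opposite (μ e)) →
    ∀ K → ⌈ (2 ℕ.+ m) ^ 2 /2⌉ ℕ.≤ gap D K
  straight-opposite-gap {s} {t} (rows , tops) opp K = ℕ.≤-trans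
    (staircase-bound (2 ℕ.+ m) (opposite s) (opposite t) (K + D (0F , zero)))
    (ℕ.≤-reflexive (trans (sum-cong-≗ λ j → cong₂ (λ p q → ∣ p ∣ ℕ.+ ∣ q ∣) (sym (top j)) (sym (bottom j)))
                          (sym (gap-columns D K))))
    where
    open ≡-Reasoning
    δ-opposite : ∀ s → δ s (opposite s) ≡ ±1 (opposite s)
    δ-opposite ⊕ = refl
    δ-opposite ⊖ = refl
    step-opposite : ∀ e {s} → μ e ≡ s → D (target e) ≡ D (source e) + ±1 (opposite s)
    step-opposite e refl = trans (D-step e) (cong (λ d → D (source e) + d)
      (trans (cong (δ (μ e)) (opp e)) (δ-opposite (μ e))))
    start : ∀ x t → x ≡ x + t * 0ℤ
    start = solve-∀
    advance : ∀ x t k → x + t * k + t ≡ x + t * (+ 1 + k)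
    advance = solve-∀
    row : ∀ j → D (0F , j) ≡ D (0F , zero) + ±1 (opposite t) * + toℕ j
    row = <-weakInduction _ (start (D (0F , zero)) (±1 (opposite t))) λ k eq → begin
      D (0F , suc k)                                                          ≡⟨ step-opposite (vertical 0F k) (tops k) ⟩
      D (0F , inject₁ k) + ±1 (opposite t)                                    ≡⟨ cong (_+ ±1 (opposite t)) eq ⟩
      D (0F , zero) + ±1 (opposite t) * + toℕ (inject₁ k) + ±1 (opposite t)   ≡⟨ advance (D (0F , zero)) (±1 (opposite t)) (+ toℕ (inject₁ k)) ⟩
      D (0F , zero) + ±1 (opposite t) * + suc (toℕ (inject₁ k))               ≡⟨ cong (λ i → D (0F , zero) + ±1 (opposite t) * + suc i) (Fin.toℕ-inject₁ k) ⟩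
      D (0F , zero) + ±1 (opposite t) * + suc (toℕ k)                         ∎
    top : ∀ j → K + D (0F , j) ≡ K + D (0F , zero) + ±1 (opposite t) * + toℕ j
    top j = trans (cong (λ d → K + d) (row j)) (sym (ℤ.+-assoc K _ _))
    bottom : ∀ j → K + D (1F , j) ≡ K + D (0F , zero) + ±1 (opposite t) * + toℕ j + ±1 (opposite s)
    bottom j = trans (cong (λ d → K + d) (step-opposite (horizontal j) (rows j)))
              (trans (sym (ℤ.+-assoc K _ _)) (cong (_+ ±1 (opposite s)) (top j)))

-- The straight shape of a degree-two vertex makes the lower bound meet the upper one, which
-- determines the minimal gap.
opposite-distance : (x y : Vertex (2 ℕ.+ m)) → Opposite (proj₁ x) (proj₁ y) → HasDegree x 2 →
  IsDistance x y ⌈ (2 ℕ.+ m) ^ 2 /2⌉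
opposite-distance x y (_ , opp) degree = let s , t , straight = degree-two⇒straight x degree in
  subst (IsDistance x y)
    (ℕ.≤-antisym (gap-min-bound x y) (straight-opposite-gap x y straight opp (proj₁ (gap-min x y))))
    (distance x y)

theorem5p8 : ∀ (n : ℕ) (2≤n : 2 ≤ n) →
    (∀ (x₁ x₂ : Vertex n) →
    (∃₂ λ (γ β : Coloring n) →
    Proper γ × Proper β × Corresponds γ (proj₁ x₁) × Corresponds β (proj₁ x₂) ×
    (∀ (P : ∀ v → Path (v₁₁ 2≤n) v) →
    ∃ λ m → IsMinOver2ℤ (halfSum γ β P) m × m ℚᵘ.≤ (+ ⌈ n ^ 2 /2⌉ ℚᵘ./ 1)))
    × (∃ λ d → IsDistance x₁ x₂ d × d ≤ ⌈ n ^ 2 /2⌉))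
    × (∀ (x y : Vertex n) → Opposite (proj₁ x) (proj₁ y) → HasDegree x 2 → HasDegree y 2 →
    IsDistance x y ⌈ n ^ 2 /2⌉)
    × (∃₂ λ (x y : Vertex n) →
    Opposite (proj₁ x) (proj₁ y) × HasDegree x 2 × HasDegree y 2 ×
    (∃ λ d → IsDistance x y d ×
    (∀ (x′ y′ : Vertex n) (d′ : ℕ) → IsDistance x′ y′ d′ → d′ ≤ d)))
theorem5p8 (suc (suc m)) (s≤s (s≤s z≤n)) =
  (λ x₁ x₂ →
    (colouring (height (proj₁ x₁)) , colouring (height (proj₁ x₂)) ,
     colouring-proper (vertex-lifts x₁) , colouring-proper (vertex-lifts x₂) ,
     colouring-corresponds (vertex-lifts x₁) , colouring-corresponds (vertex-lifts x₂) ,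
     -- Both heights vanish at the base node, whence `refl`.
     λ P → halfSum-min (vertex-lifts x₁) (vertex-lifts x₂) (half x₁ x₂) refl P
             (proj₁ (gap-min x₁ x₂)) (proj₂ (gap-min x₁ x₂)) (gap-min-bound x₁ x₂)) ,
    bounded x₁ x₂) ,
  (λ x y opp degree _ → opposite-distance x y opp degree) ,
  -- The two staircases are an opposite degree-two pair at the distance that bounds all others.
  staircaseVertex ⊕ , staircaseVertex ⊖ , staircase-opposite ⊕ , staircase-degree ⊕ , staircase-degree ⊖ ,
  _ , opposite-distance (staircaseVertex ⊕) (staircaseVertex ⊖) (staircase-opposite ⊕) (staircase-degree ⊕) ,
  λ x y d (_ , minimal) → let d₀ , (walk , _) , d₀≤ = bounded x y in ℕ.≤-trans (minimal d₀ walk) d₀≤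
  where
  bounded : ∀ x y → ∃ λ d → IsDistance x y d × d ≤ ⌈ (2 ℕ.+ m) ^ 2 /2⌉
  bounded x y = _ , distance x y , gap-min-bound x y
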